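{- Let $m$ be a positive integer, and let $a$ be an integer that can be written as a sum of $3$ squares modulo $m$, i.e. there exist integers $z_1,z_2,z_3$ with $z_1^2+z_2^2+z_3^2\equiv a \pmod m$. Then there exists a constant $c_m>0$, depending only on $m$, such that there are infinitely many positive integers $n\equiv a \pmod m$ satisfying \[ r_3(n) \geq c_m \sqrt{n}\,\log\log n. \]
   Context: For a positive integer $n$, $r_3(n) := |\{(a,b,c)\in\mathbb{Z}^3 : a^2+b^2+c^2=n\}|$ denotes the number of representations of $n$ as a sum of three squares (counting signs and order). -}

module Defs where

open import Data.Empty using (⊥; ⊥-elim)
open import Data.Integer as ℤ using (ℤ; +_; ∣_∣)
import Data.Integer.Divisibility as ℤD
import Data.Integer.Properties as ℤP
open import Data.List using (List; length; map; filter; upTo; cartesianProduct)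
open import Data.List.Membership.Propositional using (_∈_)
open import Data.List.Membership.Propositional.Properties
  using (∈-map⁺; ∈-upTo⁺; ∈-filter⁺; ∈-filter⁻; ∈-cartesianProduct⁺)
open import Data.List.Relation.Unary.Unique.Propositional using (Unique)
import Data.List.Relation.Unary.Unique.Propositional.Properties as Unique
open import Data.Nat as ℕ using (ℕ; zero; suc)
import Data.Nat.Properties as ℕP
open import Data.Product using (Σ; ∃; ∃-syntax; _×_; _,_; proj₁; proj₂)
open import Data.Rational hiding (∣_∣)
open import Data.Rational.Properties
open import Data.Rational.Solver
open import Data.Sum as Sum using (_⊎_; inj₁; inj₂)
open import Function using (_∘_; _⇔_; mk⇔)
open import Relation.Binary.Definitions using (tri<; tri≈; tri>)
open import Relation.Binary.PropositionalEquality
open import Relation.Nullary using (Dec; yes; no)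

sumOfSquares : ℤ × ℤ × ℤ → ℤ
sumOfSquares (a , b , c) = a ℤ.* a ℤ.+ b ℤ.* b ℤ.+ c ℤ.* c

-- The integers -n, …, n.
interval : ℕ → List ℤ
interval n = map (λ i → + i ℤ.- + n) (upTo (suc (2 ℕ.* n)))

-- Solutions have coordinates of absolute value at most n, so the search
-- is confined to a box; see ∈-representations and representations-unique.
representations : ℕ → List (ℤ × ℤ × ℤ)
representations n =
  filter (λ t → sumOfSquares t ℤ.≟ + n)
    (cartesianProduct (interval n) (cartesianProduct (interval n) (interval n)))

r₃ : ℕ → ℕ
r₃ n = length (representations n)

_≡_⟨mod_⟩ : ℤ → ℤ → ℕ → Set
x ≡ y ⟨mod m ⟩ = + m ℤD.∣ (x ℤ.- y)

∣z∣≤n⇒z∈interval : ∀ n z → ∣ z ∣ ℕ.≤ n → z ∈ interval n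
∣z∣≤n⇒z∈interval n z h =
  subst (_∈ interval n) eq (∈-map⁺ (λ i → + i ℤ.- + n) (∈-upTo⁺ (ℕ.s≤s bound)))
  where
  0≤z+n : + 0 ℤ.≤ z ℤ.+ + n
  0≤z+n = go z h
    where
    go : ∀ z → ∣ z ∣ ℕ.≤ n → + 0 ℤ.≤ z ℤ.+ + n
    go (+ k) _ = ℤ.+≤+ ℕ.z≤n
    go (ℤ.-[1+ k ]) le = subst (+ 0 ℤ.≤_) (sym (ℤP.⊖-≥ le)) (ℤ.+≤+ ℕ.z≤n)
  eq : + ∣ z ℤ.+ + n ∣ ℤ.- + n ≡ z
  eq = trans (cong (ℤ._- + n) (ℤP.0≤i⇒+∣i∣≡i 0≤z+n))
        (trans (ℤP.+-assoc z (+ n) (ℤ.- + n))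
          (trans (cong (λ w → z ℤ.+ w) (ℤP.+-inverseʳ (+ n))) (ℤP.+-identityʳ z)))
  bound : ∣ z ℤ.+ + n ∣ ℕ.≤ 2 ℕ.* n
  bound = ℕP.≤-trans (ℤP.∣i+j∣≤∣i∣+∣j∣ z (+ n))
            (ℕP.≤-trans (ℕP.+-monoˡ-≤ n h)
              (ℕP.≤-reflexive (cong (n ℕ.+_) (sym (ℕP.+-identityʳ n)))))

private
  square-abs : ∀ z → z ℤ.* z ≡ + (∣ z ∣ ℕ.* ∣ z ∣)
  square-abs (+ zero)     = refl
  square-abs (+ suc k)    = refl
  square-abs ℤ.-[1+ k ]   = refl

  n≤n*n : ∀ n → n ℕ.≤ n ℕ.* n
  n≤n*n zero    = ℕ.z≤n
  n≤n*n (suc n) = ℕP.m≤m+n (suc n) (n ℕ.* suc n)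

  coordinates-bounded : ∀ n a b c → sumOfSquares (a , b , c) ≡ + n →
                        ∣ a ∣ ℕ.≤ n × ∣ b ∣ ℕ.≤ n × ∣ c ∣ ℕ.≤ n
  coordinates-bounded n a b c eq = below A (ℕP.≤-trans (ℕP.m≤m+n AA BB) (ℕP.m≤m+n _ CC))
                                 , below B (ℕP.≤-trans (ℕP.m≤n+m BB AA) (ℕP.m≤m+n _ CC))
                                 , below C (ℕP.m≤n+m CC _)
    where
    A = ∣ a ∣
    B = ∣ b ∣
    C = ∣ c ∣
    AA = A ℕ.* A
    BB = B ℕ.* B
    CC = C ℕ.* C
    eqℕ : AA ℕ.+ BB ℕ.+ CC ≡ n
    eqℕ = ℤP.+-injective
      (trans (sym (cong₂ ℤ._+_ (cong₂ ℤ._+_ (square-abs a) (square-abs b)) (square-abs c))) eq)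
    below : ∀ k → k ℕ.* k ℕ.≤ AA ℕ.+ BB ℕ.+ CC → k ℕ.≤ n
    below k le = ℕP.≤-trans (n≤n*n k) (ℕP.≤-trans le (ℕP.≤-reflexive eqℕ))

∈-representations : ∀ n t → t ∈ representations n ⇔ sumOfSquares t ≡ + n
∈-representations n t@(a , b , c) = mk⇔ to from
  where
  box = cartesianProduct (interval n) (cartesianProduct (interval n) (interval n))
  to : t ∈ representations n → sumOfSquares t ≡ + n
  to t∈ = proj₂ (∈-filter⁻ (λ t → sumOfSquares t ℤ.≟ + n) {xs = box} t∈)
  from : sumOfSquares t ≡ + n → t ∈ representations n
  from eq with coordinates-bounded n a b c eq
  ... | a≤ , b≤ , c≤ = ∈-filter⁺ (λ t → sumOfSquares t ℤ.≟ + n)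
    (∈-cartesianProduct⁺ (∣z∣≤n⇒z∈interval n a a≤)
      (∈-cartesianProduct⁺ (∣z∣≤n⇒z∈interval n b b≤) (∣z∣≤n⇒z∈interval n c c≤))) eq

representations-unique : ∀ n → Unique (representations n)
representations-unique n =
  Unique.filter⁺ (λ t → sumOfSquares t ℤ.≟ + n)
    (Unique.cartesianProduct⁺ int (Unique.cartesianProduct⁺ int int))
  where
  int : Unique (interval n)
  int = Unique.map⁺ (λ {i} {j} e → ℤP.+-injective
          (trans (sym (cancel (+ i))) (trans (cong (ℤ._+ + n) e) (cancel (+ j)))))
          (Unique.upTo⁺ (suc (2 ℕ.* n)))
    where
    cancel : ∀ x → x ℤ.- + n ℤ.+ + n ≡ x
    cancel x = trans (ℤP.+-assoc x (ℤ.- + n) (+ n))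
                 (trans (cong (λ w → x ℤ.+ w) (ℤP.+-inverseˡ (+ n))) (ℤP.+-identityʳ x))

open +-*-Solver using (solve; _:+_; _:*_; _:-_; :-_; con; _:=_)

ℕ→ℚ : ℕ → ℚ
ℕ→ℚ n = + n / 1

-- 2⁻ⁱ
halfPow : ℕ → ℚ
halfPow zero    = 1ℚ
halfPow (suc i) = ½ * halfPow i

private
  0<1 : 0ℚ < 1ℚ
  0<1 = *<* (ℤ.+<+ (ℕ.s≤s ℕ.z≤n))

  0≤½ : 0ℚ ≤ ½
  0≤½ = *≤* (ℤ.+≤+ ℕ.z≤n)

  0<½ : 0ℚ < ½
  0<½ = *<* (ℤ.+<+ (ℕ.s≤s ℕ.z≤n))

  -- inequalities are reduced to sign conditions on differences,
  -- leaving polynomial identities for the ring solver; lemmas are opaque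
  -- where with-abstraction would otherwise normalise their proofs
  opaque
    dif≤ : ∀ {a b} → a ≤ b → 0ℚ ≤ b - a
    dif≤ {a} {b} h = subst (_≤ b - a) (+-inverseʳ a) (+-monoˡ-≤ (- a) h)

  opaque
    dif< : ∀ {a b} → a < b → 0ℚ < b - a
    dif< {a} {b} h = subst (_< b - a) (+-inverseʳ a) (+-monoˡ-< (- a) h)

  a+[b-a]≡b : ∀ a b → a + (b - a) ≡ b
  a+[b-a]≡b = solve 2 (λ a b → a :+ (b :- a) := b) refl

  opaque
    le : ∀ {a b d} → 0ℚ ≤ d → b - a ≡ d → a ≤ b
    le {a} {b} h refl = subst₂ _≤_ (+-identityʳ a) (a+[b-a]≡b a b) (+-monoʳ-≤ a h)

  opaque
    lt : ∀ {a b d} → 0ℚ < d → b - a ≡ d → a < b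
    lt {a} {b} h refl = subst₂ _<_ (+-identityʳ a) (a+[b-a]≡b a b) (+-monoʳ-< a h)

  *nn : ∀ {a b} → 0ℚ ≤ a → 0ℚ ≤ b → 0ℚ ≤ a * b
  *nn {a} {b} ha hb = subst (_≤ a * b) (*-zeroʳ a)
    (*-monoˡ-≤-nonNeg a {{nonNegative ha}} hb)

  opaque
    *pp : ∀ {a b} → 0ℚ < a → 0ℚ < b → 0ℚ < a * b
    *pp {a} {b} ha hb = subst (_< a * b) (*-zeroʳ a)
      (*-monoʳ-<-pos a {{positive ha}} hb)

  +nn : ∀ {a b} → 0ℚ ≤ a → 0ℚ ≤ b → 0ℚ ≤ a + b
  +nn = +-mono-≤

  +pn : ∀ {a b} → 0ℚ < a → 0ℚ ≤ b → 0ℚ < a + b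
  +pn = +-mono-<-≤

  +np : ∀ {a b} → 0ℚ ≤ a → 0ℚ < b → 0ℚ < a + b
  +np = +-mono-≤-<

  square-nn : ∀ a → 0ℚ ≤ a * a
  square-nn a with ≤-total 0ℚ a
  ... | inj₁ h = *nn h h
  ... | inj₂ h = subst (0ℚ ≤_) (solve 1 (λ a → (con 0ℚ :- a) :* (con 0ℚ :- a) := a :* a) refl a)
                   (*nn (dif≤ h) (dif≤ h))

  *mono : ∀ {a b c d} → 0ℚ ≤ a → a ≤ b → 0ℚ ≤ c → c ≤ d → a * c ≤ b * d
  *mono {a} {b} {c} {d} ha ab hc cd =
    le (+nn (*nn (dif≤ ab) (≤-trans hc cd)) (*nn ha (dif≤ cd)))
       (solve 4 (λ a b c d → b :* d :- a :* c := (b :- a) :* d :+ a :* (d :- c)) refl a b c d)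

  opaque
    square-< : ∀ {a b} → 0ℚ ≤ a → a < b → a * a < b * b
    square-< {a} {b} ha ab = lt (*pp (dif< ab) (+np ha (≤-<-trans ha ab)))
      (solve 2 (λ a b → b :* b :- a :* a := (b :- a) :* (a :+ b)) refl a b)

  opaque
    pos-factor : ∀ {a g} → 0ℚ ≤ g → 1ℚ < a * g → 0ℚ < a
    pos-factor {a} {g} hg h with 0ℚ <? a
    ... | yes p = p
    ... | no ¬p = ⊥-elim (<-irrefl refl (<-trans 0<1 (<-≤-trans h
                    (le (*nn (dif≤ (≮⇒≥ ¬p)) hg)
                        (solve 2 (λ a g → con 0ℚ :- a :* g := (con 0ℚ :- a) :* g) refl a g)))))

  ℕ→ℚ-suc : ∀ n → ℕ→ℚ (suc n) ≡ 1ℚ + ℕ→ℚ n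
  ℕ→ℚ-suc n = toℚᵘ-injective (≃ᵘ-trans {toℚᵘ (ℕ→ℚ (suc n))} (toℚᵘ-fromℚᵘ (mkℚᵘ (+ suc n) 0))
    (≃ᵘ-trans {mkℚᵘ (+ suc n) 0} eq
      (≃ᵘ-sym {toℚᵘ (1ℚ + ℕ→ℚ n)} (≃ᵘ-trans {toℚᵘ (1ℚ + ℕ→ℚ n)} (toℚᵘ-homo-+ 1ℚ (ℕ→ℚ n))
        (+ᵘ-congʳ {toℚᵘ (ℕ→ℚ n)} {mkℚᵘ (+ n) 0} (toℚᵘ 1ℚ) (toℚᵘ-fromℚᵘ (mkℚᵘ (+ n) 0)))))))
    where
    open import Data.Rational.Unnormalised as ℚᵘ using (mkℚᵘ; *≡*)
    open import Data.Rational.Unnormalised.Properties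
      using () renaming (≃-trans to ≃ᵘ-trans; ≃-sym to ≃ᵘ-sym; +-congʳ to +ᵘ-congʳ)
    eq : mkℚᵘ (+ suc n) 0 ℚᵘ.≃ mkℚᵘ (+ 1) 0 ℚᵘ.+ mkℚᵘ (+ n) 0
    eq = *≡* (cong (λ k → (+ 1 ℤ.+ k) ℤ.* + 1) (sym (ℤP.*-identityʳ (+ n))))

  ℕ→ℚ-nn : ∀ n → 0ℚ ≤ ℕ→ℚ n
  ℕ→ℚ-nn zero    = ≤-refl
  ℕ→ℚ-nn (suc n) = subst (0ℚ ≤_) (sym (ℕ→ℚ-suc n)) (+nn (<⇒≤ 0<1) (ℕ→ℚ-nn n))

  below-ℕ : ∀ x → ∃[ N ] x < ℕ→ℚ N
  below-ℕ x@(mkℚ num den-1 _) = suc ∣ num ∣ , toℚᵘ-cancel-< {x}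
    (<-respʳ-≃ {toℚᵘ x} {mkℚᵘ (+ suc ∣ num ∣) 0}
      (≃ᵘ-sym {toℚᵘ (ℕ→ℚ (suc ∣ num ∣))} (toℚᵘ-fromℚᵘ (mkℚᵘ (+ suc ∣ num ∣) 0)))
      (*<* (num-bound num)))
    where
    open import Data.Rational.Unnormalised as ℚᵘ using (mkℚᵘ; *<*)
    open import Data.Rational.Unnormalised.Properties
      using (<-respʳ-≃) renaming (≃-sym to ≃ᵘ-sym)
    num-bound : ∀ k → k ℤ.* + 1 ℤ.< + suc ∣ k ∣ ℤ.* + suc den-1
    num-bound k = subst (ℤ._< + suc ∣ k ∣ ℤ.* + suc den-1) (sym (ℤP.*-identityʳ k))
      (ℤP.≤-<-trans (i≤∣i∣ k)
        (ℤP.<-≤-trans (ℤ.+<+ (ℕP.n<1+n ∣ k ∣))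
          (subst (+ suc ∣ k ∣ ℤ.≤_) (ℤP.pos-* (suc ∣ k ∣) (suc den-1))
            (ℤ.+≤+ (ℕP.m≤m*n (suc ∣ k ∣) (suc den-1))))))
      where
      i≤∣i∣ : ∀ i → i ℤ.≤ + ∣ i ∣
      i≤∣i∣ (+ n)      = ℤP.≤-refl
      i≤∣i∣ ℤ.-[1+ n ] = ℤ.-≤+

  opaque
    archimedean : ∀ A B → 0ℚ < B → ∃[ N ] A < ℕ→ℚ N * B
    archimedean A B hB =
      let B⁻¹ = (1/ B) {{>-nonZero hB}}
          N , h = below-ℕ (A * B⁻¹)
      in N , subst (_< ℕ→ℚ N * B)
               (trans (*-assoc A B⁻¹ B)
                 (trans (cong (A *_) (*-inverseˡ B {{>-nonZero hB}})) (*-identityʳ A)))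
               (*-monoˡ-<-pos B {{positive hB}} h)

  halfPow-pos : ∀ i → 0ℚ < halfPow i
  halfPow-pos zero    = 0<1
  halfPow-pos (suc i) = *pp 0<½ (halfPow-pos i)

  halfPow-decay : ∀ i → halfPow i * (1ℚ + ℕ→ℚ i) ≤ 1ℚ
  halfPow-decay zero    = ≤-refl
  halfPow-decay (suc i) = ≤-trans
    (subst (λ z → ½ * h * (1ℚ + z) ≤ h * (1ℚ + x)) (sym (ℕ→ℚ-suc i))
      (le (*nn (*nn 0≤½ (<⇒≤ (halfPow-pos i))) (ℕ→ℚ-nn i))
        (solve 2 (λ h x → h :* (con 1ℚ :+ x) :- con ½ :* h :* (con 1ℚ :+ (con 1ℚ :+ x))
                       := con ½ :* h :* x) refl h x)))
    (halfPow-decay i)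
    where
    h = halfPow i
    x = ℕ→ℚ i

  opaque
    halfPow-small : ∀ A B → 0ℚ < B → ∃[ i ] halfPow i * A < B
    halfPow-small A B hB =
      let N , A<NB = archimedean A B hB
          h  = halfPow N
          hp = halfPow-pos N
      in N , <-≤-trans
          (*-monoʳ-<-pos h {{positive hp}} A<NB)
          (≤-trans (le (*nn (<⇒≤ hp) (<⇒≤ hB))
                     (solve 3 (λ h x B → h :* (con 1ℚ :+ x) :* B :- h :* (x :* B) := h :* B)
                        refl h (ℕ→ℚ N) B))
                   (subst (h * (1ℚ + ℕ→ℚ N) * B ≤_) (*-identityˡ B)
                     (*-monoʳ-≤-nonNeg B {{nonNegative (<⇒≤ hB)}} (halfPow-decay N))))

  halfPow≤1 : ∀ i → halfPow i ≤ 1ℚ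
  halfPow≤1 zero    = ≤-refl
  halfPow≤1 (suc i) = ≤-trans
    (le (*nn 0≤½ (<⇒≤ (halfPow-pos i)))
        (solve 1 (λ h → h :- con ½ :* h := con ½ :* h) refl (halfPow i)))
    (halfPow≤1 i)

  opaque
    small : ∀ A B → 0ℚ < B → ∃[ h ] 0ℚ < h × h < 1ℚ × h * A < B
    small A B hB =
      let i , p = halfPow-small (½ * A) B hB
          h     = halfPow i
      in ½ * h , *pp 0<½ (halfPow-pos i)
        , lt {½ * h} {1ℚ} (+pn 0<½ (*nn 0≤½ (dif≤ (halfPow≤1 i))))
            (solve 1 (λ h → con 1ℚ :- con ½ :* h := con ½ :+ con ½ :* (con 1ℚ :- h)) refl h)
        , subst (_< B) (solve 2 (λ h A → h :* (con ½ :* A) := con ½ :* h :* A) refl h A) p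

  -- lowering a factor slightly keeps a strict inequality
  opaque
    shrink : ∀ {c b g} → c < b * g → ∃[ b' ] b' < b × c < b' * g
    shrink {c} {b} {g} h with small g (b * g - c) (dif< h)
    ... | δ , δ>0 , _ , p = b - δ
      , lt δ>0 (solve 2 (λ b δ → b :- (b :- δ) := δ) refl b δ)
      , lt (dif< p) (solve 4 (λ b g c δ → (b :- δ) :* g :- c := b :* g :- c :- δ :* g) refl b g c δ)

  opaque
    root-below : ∀ {c e} → 0ℚ ≤ c → 0ℚ < e → c < e * e →
                 ∃[ c' ] 0ℚ < c' × c' < e × c < c' * c'
    root-below {c} {e} hc he h with small (e * e + e * e) (e * e - c) (dif< h)
    ... | δ , δ>0 , δ<1 , p = (1ℚ - δ) * e
      , *pp (dif< δ<1) he
      , lt (*pp δ>0 he) (solve 2 (λ e δ → e :- (con 1ℚ :- δ) :* e := δ :* e) refl e δ)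
      , lt (+pn (dif< p) (square-nn (δ * e)))
           (solve 3 (λ e δ c → (con 1ℚ :- δ) :* e :* ((con 1ℚ :- δ) :* e) :- c
               := e :* e :- c :- δ :* (e :* e :+ e :* e) :+ δ :* e :* (δ :* e)) refl e δ c)

-- Two-sided Dedekind cuts: L q means q < x, and U q means x < q.
record ℝ : Set₁ where
  field
    L U         : ℚ → Set
    L-inhabited : ∃ L
    U-inhabited : ∃ U
    L-lower     : ∀ {p q} → p < q → L q → L p
    U-upper     : ∀ {p q} → p < q → U p → U q
    L-open      : ∀ {p} → L p → ∃[ q ] p < q × L q
    U-open      : ∀ {q} → U q → ∃[ p ] p < q × U p
    disjoint    : ∀ {q} → L q → U q → ⊥
    located     : ∀ {p q} → p < q → L p ⊎ U q

open ℝ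

infix 4 _<ℝ_ _≤ℝ_
infixl 7 _*ℝ_

_<ℝ_ : ℝ → ℝ → Set
x <ℝ y = ∃[ q ] U x q × L y q

_≤ℝ_ : ℝ → ℝ → Set
x ≤ℝ y = ∀ q → L x q → L y q

private
  L<U : ∀ x {p q} → L x p → U x q → p < q
  L<U x {p} {q} lp uq with <-cmp p q
  ... | tri< h _ _ = h
  ... | tri≈ _ refl _ = ⊥-elim (disjoint x lp uq)
  ... | tri> _ _ h = ⊥-elim (disjoint x lp (U-upper x h uq))

  L-⊔ : ∀ x {p q} → L x p → L x q → L x (p ⊔ q)
  L-⊔ x {p} {q} lp lq with ⊔-sel p q
  ... | inj₁ e = subst (L x) (sym e) lp
  ... | inj₂ e = subst (L x) (sym e) lq

fromℚ : ℚ → ℝ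
fromℚ r = record
  { L           = _< r
  ; U           = r <_
  ; L-inhabited = r - 1ℚ , lt 0<1 (solve 1 (λ r → r :- (r :- con 1ℚ) := con 1ℚ) refl r)
  ; U-inhabited = r + 1ℚ , lt 0<1 (solve 1 (λ r → r :+ con 1ℚ :- r := con 1ℚ) refl r)
  ; L-lower     = <-trans
  ; U-upper     = λ p<q r<p → <-trans r<p p<q
  ; L-open      = <-dense
  ; U-open      = λ h → let s , r<s , s<q = <-dense h in s , s<q , r<s
  ; disjoint    = λ q<r r<q → <-irrefl refl (<-trans q<r r<q)
  ; located     = λ {p} {q} → loc p q
  }
  where
  loc : ∀ p q → p < q → p < r ⊎ r < q
  loc p q p<q with p <? r
  ... | yes h = inj₁ h
  ... | no ¬h = inj₂ (≤-<-trans (≮⇒≥ ¬h) p<q)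

fromℕ : ℕ → ℝ
fromℕ = fromℚ ∘ ℕ→ℚ

0ℝ : ℝ
0ℝ = fromℚ 0ℚ

private
  opaque
    approximate : ∀ x δ → 0ℚ < δ → ∃[ a ] ∃[ b ] L x a × U x b × b ≤ a + (δ + δ)
    approximate x δ δ>0 =
      let a₀ , la₀ = L-inhabited x
          b₀ , ub₀ = U-inhabited x
          N , big  = archimedean (b₀ - a₀) δ δ>0
      in march b₀ ub₀ N a₀ la₀ (le (<⇒≤ (dif< big))
           (solve 4 (λ a b n δ → a :+ n :* δ :- b := n :* δ :- (b :- a)) refl a₀ b₀ (ℕ→ℚ N) δ))
      where
      march : ∀ b₀ → U x b₀ → ∀ n a → L x a → b₀ ≤ a + ℕ→ℚ n * δ →
              ∃[ a ] ∃[ b ] L x a × U x b × b ≤ a + (δ + δ)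
      march b₀ ub₀ zero a la h = ⊥-elim (<-irrefl refl (<-≤-trans (L<U x la ub₀)
        (subst (b₀ ≤_) (solve 2 (λ a δ → a :+ con 0ℚ :* δ := a) refl a δ) h)))
      march b₀ ub₀ (suc n) a la h = step (located x
          (lt δ>0 (solve 2 (λ a δ → a :+ (δ :+ δ) :- (a :+ δ) := δ) refl a δ)))
        where
        step : L x (a + δ) ⊎ U x (a + (δ + δ)) →
               ∃[ a ] ∃[ b ] L x a × U x b × b ≤ a + (δ + δ)
        step (inj₁ l) = march b₀ ub₀ n (a + δ) l (subst (b₀ ≤_)
                         (trans (cong (λ z → a + z * δ) (ℕ→ℚ-suc n))
                           (solve 3 (λ a δ n → a :+ (con 1ℚ :+ n) :* δ := a :+ δ :+ n :* δ)
                              refl a δ (ℕ→ℚ n))) h)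
        step (inj₂ u) = a , a + (δ + δ) , la , u , ≤-refl

  edge-below : ∀ {q x c d t} → c ≤ t → t ≤ d → q < x * c → q < x * d → q < x * t
  edge-below {q} {x} {c} {d} {t} ct td qc qd with ≤-total 0ℚ x
  ... | inj₁ h = <-≤-trans qc (le (*nn h (dif≤ ct))
                   (solve 3 (λ x c t → x :* t :- x :* c := x :* (t :- c)) refl x c t))
  ... | inj₂ h = <-≤-trans qd (le (*nn (dif≤ h) (dif≤ td))
                   (solve 3 (λ x d t → x :* t :- x :* d := (con 0ℚ :- x) :* (d :- t)) refl x d t))

  edge-above : ∀ {q x c d t} → c ≤ t → t ≤ d → x * c < q → x * d < q → x * t < q
  edge-above {q} {x} {c} {d} {t} ct td qc qd with ≤-total 0ℚ x
  ... | inj₁ h = ≤-<-trans (le (*nn h (dif≤ td))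
                   (solve 3 (λ x d t → x :* d :- x :* t := x :* (d :- t)) refl x d t)) qd
  ... | inj₂ h = ≤-<-trans (le (*nn (dif≤ h) (dif≤ ct))
                   (solve 3 (λ x c t → x :* c :- x :* t := (con 0ℚ :- x) :* (t :- c)) refl x c t)) qc

  swap-below : ∀ {q} x y → q < x * y → q < y * x
  swap-below {q} x y = subst (q <_) (*-comm x y)

  swap-above : ∀ {q} x y → x * y < q → y * x < q
  swap-above {q} x y = subst (_< q) (*-comm x y)

  under₂ : ∀ q w x → q < w → q < x → ∃[ r ] q < r × r < w × r < x
  under₂ q w x qw qx with ≤-total w x
  ... | inj₁ h = let r , qr , rw = <-dense qw in r , qr , rw , <-≤-trans rw h
  ... | inj₂ h = let r , qr , rx = <-dense qx in r , qr , <-≤-trans rx h , rx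

  over₂ : ∀ q w x → w < q → x < q → ∃[ r ] r < q × w < r × x < r
  over₂ q w x wq xq with ≤-total w x
  ... | inj₁ h = let r , xr , rq = <-dense xq in r , rq , ≤-<-trans h xr , xr
  ... | inj₂ h = let r , wr , rq = <-dense wq in r , rq , wr , ≤-<-trans h wr

  lowerBound₂ : ∀ w x → ∃[ r ] r < w × r < x
  lowerBound₂ w x with ≤-total w x
  ... | inj₁ h = let r , rw = L-inhabited (fromℚ w) in r , rw , <-≤-trans rw h
  ... | inj₂ h = let r , rx = L-inhabited (fromℚ x) in r , <-≤-trans rx h , rx

  upperBound₂ : ∀ w x → ∃[ r ] w < r × x < r
  upperBound₂ w x with ≤-total w x
  ... | inj₁ h = let r , xr = U-inhabited (fromℚ x) in r , ≤-<-trans h xr , xr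
  ... | inj₂ h = let r , wr = U-inhabited (fromℚ w) in r , wr , ≤-<-trans h wr

  -- a magnitude bound M for a and the estimate |a v| ≤ M δ
  product-≤ : ∀ {M a v δ} → 0ℚ ≤ M → a ≤ M → 0ℚ ≤ v → v ≤ δ → a * v ≤ M * δ
  product-≤ {M} {a} {v} {δ} hM aM hv vδ = le (+nn (*nn (dif≤ aM) hv) (*nn hM (dif≤ vδ)))
    (solve 4 (λ M a v δ → M :* δ :- a :* v := (M :- a) :* v :+ M :* (δ :- v)) refl M a v δ)

  product-≥ : ∀ {M a v δ} → 0ℚ ≤ M → - M ≤ a → 0ℚ ≤ v → v ≤ δ → - (M * δ) ≤ a * v
  product-≥ {M} {a} {v} {δ} hM aM hv vδ = le (+nn (*nn (dif≤ aM) hv) (*nn hM (dif≤ vδ)))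
    (solve 4 (λ M a v δ → a :* v :- (:- (M :* δ)) := (a :- (:- M)) :* v :+ M :* (δ :- v)) refl M a v δ)

  -- M bounds the lower end of every interval around x of width at most 1
  opaque
    magnitude : ∀ x → ∃[ M ] 0ℚ ≤ M ×
      (∀ a b → L x a → U x b → b ≤ a + 1ℚ → a ≤ M × - M ≤ a)
    magnitude x =
      let a₀ , la₀ = L-inhabited x
          b₀ , ub₀ = U-inhabited x
          m        = 0ℚ ⊔ (b₀ ⊔ (- a₀))
          b₀≤m     = ≤-trans (p≤p⊔q b₀ (- a₀)) (p≤q⊔p 0ℚ (b₀ ⊔ (- a₀)))
          -a₀≤m    = ≤-trans (p≤q⊔p b₀ (- a₀)) (p≤q⊔p 0ℚ (b₀ ⊔ (- a₀)))
      in m + 1ℚ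
        , +nn (p≤p⊔q 0ℚ (b₀ ⊔ (- a₀))) (<⇒≤ 0<1)
        , λ a b la ub w
          → ≤-trans (<⇒≤ (L<U x la ub₀)) (≤-trans b₀≤m (le (<⇒≤ 0<1)
              (solve 1 (λ y → (y :+ con 1ℚ) :- y := con 1ℚ) refl m)))
          , le (+nn (dif≤ w) (+nn (<⇒≤ (dif< (L<U x la₀ ub))) (dif≤ -a₀≤m)))
              (solve 4 (λ a b a₀ m → a :- (:- (m :+ con 1ℚ))
                  := (a :+ con 1ℚ :- b) :+ ((b :- a₀) :+ (m :- (:- a₀)))) refl a b a₀ m)

  -- if a and c have magnitude at most M and the intervals [a , b], [c , d]
  -- have length at most δ, then the corners of the product lie within
  -- 2 M δ + δ of a c
  corners : ∀ {a b c d M δ p q} → 0ℚ ≤ M → 0ℚ < δ → δ < 1ℚ →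
    a ≤ M → - M ≤ a → c ≤ M → - M ≤ c →
    a ≤ b → b ≤ a + δ → c ≤ d → d ≤ c + δ →
    δ * (M + M + 1ℚ) < ½ * (q - p) →
    (p < a * c × p < a * d × p < b * c × p < b * d) ⊎
    (a * c < q × a * d < q × b * c < q × b * d < q)
  corners {a} {b} {c} {d} {M} {δ} {p} {q} hM δ>0 δ<1 a≤M -M≤a c≤M -M≤c a≤b b≤ c≤d d≤ δ-small =
    decide (½ * (p + q) <? a * c)
    where
    w≥0 : 0ℚ ≤ b - a
    w≥0 = dif≤ a≤b
    v≥0 : 0ℚ ≤ d - c
    v≥0 = dif≤ c≤d
    w≤δ : b - a ≤ δ
    w≤δ = le (dif≤ b≤) (solve 3 (λ a b δ → δ :- (b :- a) := a :+ δ :- b) refl a b δ)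
    v≤δ : d - c ≤ δ
    v≤δ = le (dif≤ d≤) (solve 3 (λ a b δ → δ :- (b :- a) := a :+ δ :- b) refl c d δ)
    K≥0 : 0ℚ ≤ M * δ
    K≥0 = *nn hM (<⇒≤ δ>0)
    W≤δ : (b - a) * (d - c) ≤ δ
    W≤δ = ≤-trans (*mono w≥0 (≤-trans w≤δ (<⇒≤ δ<1)) v≥0 v≤δ) (≤-reflexive (*-identityˡ δ))
    η-small : M * δ + M * δ + δ < ½ * (q - p)
    η-small = subst (_< ½ * (q - p))
      (solve 2 (λ M δ → δ :* (M :+ M :+ con 1ℚ) := M :* δ :+ M :* δ :+ δ) refl M δ) δ-small
    up : ∀ e {z} → ½ * (p + q) < a * c → - (M * δ + M * δ + δ) ≤ e → z ≡ a * c + e → p < z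
    up e h he refl = lt (+pn (dif< η-small) (+nn (<⇒≤ (dif< h)) (dif≤ he)))
      (solve 5 (λ p q z η e → z :+ e :- p
        := (con ½ :* (q :- p) :- η) :+ ((z :- con ½ :* (p :+ q)) :+ (e :- (:- η))))
        refl p q (a * c) (M * δ + M * δ + δ) e)
    down : ∀ e {z} → a * c ≤ ½ * (p + q) → e ≤ M * δ + M * δ + δ → z ≡ a * c + e → z < q
    down e h he refl = lt (+pn (dif< η-small) (+nn (dif≤ h) (dif≤ he)))
      (solve 5 (λ p q z η e → q :- (z :+ e)
        := (con ½ :* (q :- p) :- η) :+ ((con ½ :* (p :+ q) :- z) :+ (η :- e)))
        refl p q (a * c) (M * δ + M * δ + δ) e)
    eq₁ : a * c ≡ a * c + 0ℚ
    eq₁ = sym (+-identityʳ (a * c))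
    eq₂ : a * d ≡ a * c + a * (d - c)
    eq₂ = solve 3 (λ a c d → a :* d := a :* c :+ a :* (d :- c)) refl a c d
    eq₃ : b * c ≡ a * c + c * (b - a)
    eq₃ = solve 3 (λ a b c → b :* c := a :* c :+ c :* (b :- a)) refl a b c
    eq₄ : b * d ≡ a * c + (a * (d - c) + c * (b - a) + (b - a) * (d - c))
    eq₄ = solve 4 (λ a b c d → b :* d
            := a :* c :+ (a :* (d :- c) :+ c :* (b :- a) :+ (b :- a) :* (d :- c))) refl a b c d
    lo₁ : - (M * δ + M * δ + δ) ≤ 0ℚ
    lo₁ = le (+nn (+nn K≥0 K≥0) (<⇒≤ δ>0))
      (solve 1 (λ η → con 0ℚ :- (:- η) := η) refl (M * δ + M * δ + δ))
    lo₂ : ∀ {e} → - (M * δ) ≤ e → - (M * δ + M * δ + δ) ≤ e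
    lo₂ {e} h = le (+nn (dif≤ h) (+nn K≥0 (<⇒≤ δ>0)))
      (solve 3 (λ e K δ → e :- (:- (K :+ K :+ δ)) := (e :- (:- K)) :+ (K :+ δ)) refl e (M * δ) δ)
    lo₄ : - (M * δ + M * δ + δ) ≤ a * (d - c) + c * (b - a) + (b - a) * (d - c)
    lo₄ = le (+nn (+nn (dif≤ (product-≥ hM -M≤a v≥0 v≤δ)) (dif≤ (product-≥ hM -M≤c w≥0 w≤δ)))
                  (+nn (*nn w≥0 v≥0) (<⇒≤ δ>0)))
      (solve 5 (λ A C W K δ → A :+ C :+ W :- (:- (K :+ K :+ δ))
        := ((A :- (:- K)) :+ (C :- (:- K))) :+ (W :+ δ)) refl
        (a * (d - c)) (c * (b - a)) ((b - a) * (d - c)) (M * δ) δ)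
    hi₁ : 0ℚ ≤ M * δ + M * δ + δ
    hi₁ = +nn (+nn K≥0 K≥0) (<⇒≤ δ>0)
    hi₂ : ∀ {e} → e ≤ M * δ → e ≤ M * δ + M * δ + δ
    hi₂ {e} h = le (+nn (dif≤ h) (+nn K≥0 (<⇒≤ δ>0)))
      (solve 3 (λ e K δ → K :+ K :+ δ :- e := (K :- e) :+ (K :+ δ)) refl e (M * δ) δ)
    hi₄ : a * (d - c) + c * (b - a) + (b - a) * (d - c) ≤ M * δ + M * δ + δ
    hi₄ = +-mono-≤ (+-mono-≤ (product-≤ hM a≤M v≥0 v≤δ) (product-≤ hM c≤M w≥0 w≤δ)) W≤δ
    decide : Dec (½ * (p + q) < a * c) →
      (p < a * c × p < a * d × p < b * c × p < b * d) ⊎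
      (a * c < q × a * d < q × b * c < q × b * d < q)
    decide (yes h) = inj₁
      ( up 0ℚ h lo₁ eq₁
      , up (a * (d - c)) h (lo₂ (product-≥ hM -M≤a v≥0 v≤δ)) eq₂
      , up (c * (b - a)) h (lo₂ (product-≥ hM -M≤c w≥0 w≤δ)) eq₃
      , up (a * (d - c) + c * (b - a) + (b - a) * (d - c)) h lo₄ eq₄)
    decide (no ¬h) = inj₂
      ( down 0ℚ (≮⇒≥ ¬h) hi₁ eq₁
      , down (a * (d - c)) (≮⇒≥ ¬h) (hi₂ (product-≤ hM a≤M v≥0 v≤δ)) eq₂
      , down (c * (b - a)) (≮⇒≥ ¬h) (hi₂ (product-≤ hM c≤M w≥0 w≤δ)) eq₃
      , down (a * (d - c) + c * (b - a) + (b - a) * (d - c)) (≮⇒≥ ¬h) hi₄ eq₄)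

-- Interval arithmetic: q < x y iff q lies below all corners of the product
-- of some rational interval around x with one around y.
_*ℝ_ : ℝ → ℝ → ℝ
x *ℝ y = record
  { L           = mL
  ; U           = mU
  ; L-inhabited =
      let (a , la) , (b , ub) = L-inhabited x , U-inhabited x
          (c , lc) , (d , ud) = L-inhabited y , U-inhabited y
          r₁ , h₁ , h₂ = lowerBound₂ (a * c) (a * d)
          r₂ , h₃ , h₄ = lowerBound₂ (b * c) (b * d)
          r , k₁ , k₂ = lowerBound₂ r₁ r₂
      in r , a , b , c , d , la , ub , lc , ud
         , <-trans k₁ h₁ , <-trans k₁ h₂ , <-trans k₂ h₃ , <-trans k₂ h₄
  ; U-inhabited =
      let (a , la) , (b , ub) = L-inhabited x , U-inhabited x
          (c , lc) , (d , ud) = L-inhabited y , U-inhabited y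
          r₁ , h₁ , h₂ = upperBound₂ (a * c) (a * d)
          r₂ , h₃ , h₄ = upperBound₂ (b * c) (b * d)
          r , k₁ , k₂ = upperBound₂ r₁ r₂
      in r , a , b , c , d , la , ub , lc , ud
         , <-trans h₁ k₁ , <-trans h₂ k₁ , <-trans h₃ k₂ , <-trans h₄ k₂
  ; L-lower     = λ { p<q (a , b , c , d , la , ub , lc , ud , h₁ , h₂ , h₃ , h₄) →
      a , b , c , d , la , ub , lc , ud
      , <-trans p<q h₁ , <-trans p<q h₂ , <-trans p<q h₃ , <-trans p<q h₄ }
  ; U-upper     = λ { p<q (a , b , c , d , la , ub , lc , ud , h₁ , h₂ , h₃ , h₄) →
      a , b , c , d , la , ub , lc , ud
      , <-trans h₁ p<q , <-trans h₂ p<q , <-trans h₃ p<q , <-trans h₄ p<q }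
  ; L-open      = λ { {q} (a , b , c , d , la , ub , lc , ud , h₁ , h₂ , h₃ , h₄) →
      let r₁ , q₁ , i₁ , i₂ = under₂ q (a * c) (a * d) h₁ h₂
          r₂ , q₂ , i₃ , i₄ = under₂ q (b * c) (b * d) h₃ h₄
          r , qr , k₁ , k₂ = under₂ q r₁ r₂ q₁ q₂
      in r , qr , a , b , c , d , la , ub , lc , ud
         , <-trans k₁ i₁ , <-trans k₁ i₂ , <-trans k₂ i₃ , <-trans k₂ i₄ }
  ; U-open      = λ { {q} (a , b , c , d , la , ub , lc , ud , h₁ , h₂ , h₃ , h₄) →
      let r₁ , q₁ , i₁ , i₂ = over₂ q (a * c) (a * d) h₁ h₂
          r₂ , q₂ , i₃ , i₄ = over₂ q (b * c) (b * d) h₃ h₄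
          r , qr , k₁ , k₂ = over₂ q r₁ r₂ q₁ q₂
      in r , qr , a , b , c , d , la , ub , lc , ud
         , <-trans i₁ k₁ , <-trans i₂ k₁ , <-trans i₃ k₂ , <-trans i₄ k₂ }
  ; disjoint    = disj
  ; located     = loc
  }
  where
  mL mU : ℚ → Set
  mL q = ∃[ a ] ∃[ b ] ∃[ c ] ∃[ d ] L x a × U x b × L y c × U y d ×
           q < a * c × q < a * d × q < b * c × q < b * d
  mU q = ∃[ a ] ∃[ b ] ∃[ c ] ∃[ d ] L x a × U x b × L y c × U y d ×
           a * c < q × a * d < q × b * c < q × b * d < q

  disj : ∀ {q} → mL q → mU q → ⊥
  disj {q} (a , b , c , d , la , ub , lc , ud , h₁ , h₂ , h₃ , h₄)
       (a' , b' , c' , d' , la' , ub' , lc' , ud' , k₁ , k₂ , k₃ , k₄) =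
    <-irrefl refl (<-trans
      (swap-below t s (edge-below {x = t} (p≤p⊔q a a') (<⇒≤ (L<U x ls ub))
        (swap-below a t (edge-below {x = a} ct td h₁ h₂))
        (swap-below b t (edge-below {x = b} ct td h₃ h₄))))
      (swap-above t s (edge-above {x = t} (p≤q⊔p a a') (<⇒≤ (L<U x ls ub'))
        (swap-above a' t (edge-above {x = a'} ct' td' k₁ k₂))
        (swap-above b' t (edge-above {x = b'} ct' td' k₃ k₄)))))
    where
    s   = a ⊔ a'
    t   = c ⊔ c'
    ls  = L-⊔ x la la'
    lt' = L-⊔ y lc lc'
    ct  = p≤p⊔q c c'
    ct' = p≤q⊔p c c'
    td  = <⇒≤ (L<U y lt' ud)
    td' = <⇒≤ (L<U y lt' ud')

  loc : ∀ {p q} → p < q → mL p ⊎ mU q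
  loc {p} {q} p<q =
    let M₁ , hM₁ , bd₁ = magnitude x
        M₂ , hM₂ , bd₂ = magnitude y
        M₁≤M = le hM₂ (solve 2 (λ m n → m :+ n :- m := n) refl M₁ M₂)
        M₂≤M = le hM₁ (solve 2 (λ m n → m :+ n :- n := m) refl M₁ M₂)
        δ , δ>0 , δ<1 , δ-small =
          small (M₁ + M₂ + (M₁ + M₂) + 1ℚ) (½ * (q - p)) (*pp 0<½ (dif< p<q))
        a , b , la , ub , b≤ = approximate x (½ * δ) (*pp 0<½ δ>0)
        c , d , lc , ud , d≤ = approximate y (½ * δ) (*pp 0<½ δ>0)
        b≤a+δ = subst (b ≤_) (½δ+½δ a δ) b≤
        d≤c+δ = subst (d ≤_) (½δ+½δ c δ) d≤
        a≤M₁ , -M₁≤a = bd₁ a b la ub (≤-trans b≤a+δ (+-monoʳ-≤ a (<⇒≤ δ<1)))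
        c≤M₂ , -M₂≤c = bd₂ c d lc ud (≤-trans d≤c+δ (+-monoʳ-≤ c (<⇒≤ δ<1)))
    in Sum.map (λ h → a , b , c , d , la , ub , lc , ud , h)
               (λ h → a , b , c , d , la , ub , lc , ud , h)
         (corners {M = M₁ + M₂} (+nn hM₁ hM₂) δ>0 δ<1
           (≤-trans a≤M₁ M₁≤M) (≤-trans (neg-antimono-≤ M₁≤M) -M₁≤a)
           (≤-trans c≤M₂ M₂≤M) (≤-trans (neg-antimono-≤ M₂≤M) -M₂≤c)
           (<⇒≤ (L<U x la ub)) b≤a+δ (<⇒≤ (L<U y lc ud)) d≤c+δ δ-small)
    where
    ½δ+½δ : ∀ a δ → a + (½ * δ + ½ * δ) ≡ a + δ
    ½δ+½δ = solve 2 (λ a δ → a :+ (con ½ :* δ :+ con ½ :* δ) := a :+ δ) refl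

-- On negative arguments the value is 0.
sqrt : ℝ → ℝ
sqrt x = record
  { L           = sL
  ; U           = sU
  ; L-inhabited = - 1ℚ , inj₁ (*<* ℤ.-<+)
  ; U-inhabited =
      let s , us = U-inhabited x
          r , 1<r , s<r = upperBound₂ 1ℚ s
          0<r = <-trans 0<1 1<r
      in r , 0<r , U-upper x (<-trans s<r
           (lt (*pp 0<r (dif< 1<r))
             (solve 1 (λ r → r :* r :- r := r :* (r :- con 1ℚ)) refl r))) us
  ; L-lower     = λ {p} {q} → lower p q
  ; U-upper     = λ { p<q (0<p , u) → <-trans 0<p p<q , U-upper x (square-< (<⇒≤ 0<p) p<q) u }
  ; L-open      = λ {p} → L-op p
  ; U-open      = λ {q} → U-op q
  ; disjoint    = λ { (inj₁ q<0) (0<q , _) → <-irrefl refl (<-trans q<0 0<q)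
                    ; (inj₂ l)   (_ , u)   → disjoint x l u }
  ; located     = λ {p} {q} → loc p q
  }
  where
  sL sU : ℚ → Set
  sL q = q < 0ℚ ⊎ L x (q * q)
  sU q = 0ℚ < q × U x (q * q)

  lower : ∀ p q → p < q → sL q → sL p
  lower p q p<q (inj₁ q<0) = inj₁ (<-trans p<q q<0)
  lower p q p<q (inj₂ l) with p <? 0ℚ
  ... | yes p<0 = inj₁ p<0
  ... | no p≮0  = inj₂ (L-lower x (square-< (≮⇒≥ p≮0) p<q) l)

  L-op : ∀ p → sL p → ∃[ q ] p < q × sL q
  L-op p (inj₁ p<0) = let r , pr , r<0 = <-dense p<0 in r , pr , inj₁ r<0
  L-op p (inj₂ l) with L-open x l
  ... | r , pp<r , lr with small (p + p + 1ℚ) (r - p * p) (dif< pp<r)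
  ...   | δ , δ>0 , δ<1 , h = p + δ
    , lt δ>0 (solve 2 (λ p δ → p :+ δ :- p := δ) refl p δ)
    , inj₂ (L-lower x (lt (+pn (dif< h) (*nn (<⇒≤ δ>0) (<⇒≤ (dif< δ<1))))
        (solve 3 (λ p δ r → r :- (p :+ δ) :* (p :+ δ)
          := (r :- p :* p :- δ :* (p :+ p :+ con 1ℚ)) :+ δ :* (con 1ℚ :- δ)) refl p δ r)) lr)

  U-op : ∀ q → sU q → ∃[ p ] p < q × sU p
  U-op q (0<q , u) with U-open x u
  ... | r , r<qq , ur with root-below {0ℚ ⊔ r} {q} (p≤p⊔q 0ℚ r) 0<q max<
    where
    max< : 0ℚ ⊔ r < q * q
    max< with ⊔-sel 0ℚ r
    ... | inj₁ e = subst (_< q * q) (sym e) (*pp 0<q 0<q)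
    ... | inj₂ e = subst (_< q * q) (sym e) r<qq
  ...   | c , 0<c , c<q , h = c , c<q , 0<c , U-upper x (≤-<-trans (p≤q⊔p 0ℚ r) h) ur

  loc : ∀ p q → p < q → sL p ⊎ sU q
  loc p q p<q with p <? 0ℚ
  ... | yes p<0 = inj₁ (inj₁ p<0)
  ... | no p≮0 with located x (square-< (≮⇒≥ p≮0) p<q)
  ...   | inj₁ l = inj₁ (inj₂ l)
  ...   | inj₂ u = inj₂ (≤-<-trans (≮⇒≥ p≮0) p<q , u)

-- (max 0 (1 + q/2ⁱ)) ^ 2ⁱ, which increases to exp q
expApprox : ℕ → ℚ → ℚ
expApprox zero    q = 0ℚ ⊔ (1ℚ + q)
expApprox (suc i) q = expApprox i (½ * q) * expApprox i (½ * q)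

private
  E = expApprox

  E-nn : ∀ i q → 0ℚ ≤ E i q
  E-nn zero    q = p≤p⊔q 0ℚ (1ℚ + q)
  E-nn (suc i) q = *nn (E-nn i (½ * q)) (E-nn i (½ * q))

  E₀-cases : ∀ q → (E 0 q ≡ 0ℚ × 1ℚ + q ≤ 0ℚ) ⊎ (E 0 q ≡ 1ℚ + q × 0ℚ ≤ 1ℚ + q)
  E₀-cases q with ≤-total (1ℚ + q) 0ℚ
  ... | inj₁ h = inj₁ (p≥q⇒p⊔q≡p h , h)
  ... | inj₂ h = inj₂ (p≤q⇒p⊔q≡q h , h)

  E-step : ∀ i q → E i q ≤ E (suc i) q
  E-step zero q with E₀-cases q
  ... | inj₁ (e , _) = subst (_≤ E 1 q) (sym e) (E-nn 1 q)
  ... | inj₂ (e , h) = subst (_≤ E 1 q) (sym e)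
    (≤-trans (le (square-nn (½ * q))
        (solve 1 (λ q → (con 1ℚ :+ con ½ :* q) :* (con 1ℚ :+ con ½ :* q) :- (con 1ℚ :+ q)
            := con ½ :* q :* (con ½ :* q)) refl q))
      (*mono k (p≤q⊔p 0ℚ _) k (p≤q⊔p 0ℚ _)))
    where
    k : 0ℚ ≤ 1ℚ + ½ * q
    k = subst (0ℚ ≤_) (solve 1 (λ q → con ½ :* (con 1ℚ :+ q) :+ con ½ := con 1ℚ :+ con ½ :* q) refl q)
          (+nn (*nn 0≤½ h) 0≤½)
  E-step (suc i) q = *mono (E-nn i _) (E-step i _) (E-nn i _) (E-step i _)

  E-mono : ∀ i n q → E i q ≤ E (n ℕ.+ i) q
  E-mono i zero    q = ≤-refl
  E-mono i (suc n) q = ≤-trans (E-mono i n q) (E-step (n ℕ.+ i) q)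

  ½-neg : ∀ q → ½ * (- q) ≡ - (½ * q)
  ½-neg = solve 1 (λ q → con ½ :* (:- q) := :- (con ½ :* q)) refl

  E-inverse-≤ : ∀ i q → E i q * E i (- q) ≤ 1ℚ
  E-inverse-≤ zero q with E₀-cases q
  ... | inj₁ (e , _) = subst (λ z → z * E 0 (- q) ≤ 1ℚ) (sym e)
          (subst (_≤ 1ℚ) (sym (*-zeroˡ (E 0 (- q)))) (<⇒≤ 0<1))
  ... | inj₂ (e , _) with E₀-cases (- q)
  ...   | inj₁ (e' , _) = subst (λ z → E 0 q * z ≤ 1ℚ) (sym e')
            (subst (_≤ 1ℚ) (sym (*-zeroʳ (E 0 q))) (<⇒≤ 0<1))
  ...   | inj₂ (e' , _) = subst₂ (λ y z → y * z ≤ 1ℚ) (sym e) (sym e')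
            (le (square-nn q)
              (solve 1 (λ q → con 1ℚ :- (con 1ℚ :+ q) :* (con 1ℚ :+ (:- q)) := q :* q) refl q))
  E-inverse-≤ (suc i) q = subst (_≤ 1ℚ)
      (trans (solve 2 (λ x y → x :* y :* (x :* y) := x :* x :* (y :* y)) refl x (E i (- (½ * q))))
        (cong (λ z → x * x * (E i z * E i z)) (sym (½-neg q))))
      (*mono nn (E-inverse-≤ i (½ * q)) nn (E-inverse-≤ i (½ * q)))
    where
    x = E i (½ * q)
    nn : 0ℚ ≤ E i (½ * q) * E i (- (½ * q))
    nn = *nn (E-nn i _) (E-nn i _)

  E-inverse-≤′ : ∀ i j q → E i q * E j (- q) ≤ 1ℚ
  E-inverse-≤′ i j q = ≤-trans
    (*mono (E-nn i q) (E-mono i j q) (E-nn j (- q))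
      (subst (λ k → E j (- q) ≤ E k (- q)) (ℕP.+-comm i j) (E-mono j i (- q))))
    (E-inverse-≤ (j ℕ.+ i) q)

  -- a quantitative form of exp q / exp p ≥ 1 + (q - p)
  E-quotient : ∀ i p q → p ≤ q → 1ℚ + (q - p) - halfPow i * (p * q) ≤ E i q * E i (- p)
  E-quotient zero p q p≤q with E₀-cases q
  ... | inj₂ (e , h) = ≤-trans
      (le ≤-refl (solve 2 (λ p q → (con 1ℚ :+ q) :* (con 1ℚ :+ (:- p))
            :- (con 1ℚ :+ (q :- p) :- con 1ℚ :* (p :* q)) := con 0ℚ) refl p q))
      (subst (λ z → (1ℚ + q) * (1ℚ + (- p)) ≤ z * E 0 (- p)) (sym e)
        (*-monoˡ-≤-nonNeg (1ℚ + q) {{nonNegative h}} (p≤q⊔p 0ℚ (1ℚ + (- p)))))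
  ... | inj₁ (_ , h) = ≤-trans
      (le (*nn (dif≤ h) (subst (0ℚ ≤_)
             (solve 2 (λ p q → (con 0ℚ :- (con 1ℚ :+ q)) :+ ((q :- p) :+ (con 1ℚ :+ con 1ℚ))
                            := con 1ℚ :+ (:- p)) refl p q)
             (+nn (dif≤ h) (+nn (dif≤ p≤q) (<⇒≤ (*<* (ℤ.+<+ (ℕ.s≤s ℕ.z≤n))))))))
          (solve 2 (λ p q → con 0ℚ :- (con 1ℚ :+ (q :- p) :- con 1ℚ :* (p :* q))
                         := (con 0ℚ :- (con 1ℚ :+ q)) :* (con 1ℚ :+ (:- p))) refl p q))
      (*nn (E-nn 0 q) (E-nn 0 (- p)))
  E-quotient (suc i) p q p≤q = ≤-trans (≤-trans bernoulli (square-≥ t))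
      (≤-reflexive (trans (solve 2 (λ x y → x :* y :* (x :* y) := x :* x :* (y :* y)) refl x y)
        (cong (λ z → x * x * (E i z * E i z)) (sym (½-neg p)))))
    where
    x = E i (½ * q)
    y = E i (- (½ * p))
    t = x * y
    square-≥ : ∀ t → t + t - 1ℚ ≤ t * t
    square-≥ t = le (square-nn (t - 1ℚ))
      (solve 1 (λ t → t :* t :- (t :+ t :- con 1ℚ) := (t :- con 1ℚ) :* (t :- con 1ℚ)) refl t)
    ih = E-quotient i (½ * p) (½ * q) (*-monoˡ-≤-nonNeg ½ p≤q)
    bernoulli : 1ℚ + (q - p) - ½ * halfPow i * (p * q) ≤ t + t - 1ℚ
    bernoulli = le (+nn (dif≤ ih) (dif≤ ih))
      (solve 4 (λ p q h t → t :+ t :- con 1ℚ :- (con 1ℚ :+ (q :- p) :- con ½ :* h :* (p :* q))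
        := (t :- (con 1ℚ :+ (con ½ :* q :- con ½ :* p) :- h :* (con ½ :* p :* (con ½ :* q))))
        :+ (t :- (con 1ℚ :+ (con ½ :* q :- con ½ :* p) :- h :* (con ½ :* p :* (con ½ :* q)))))
        refl p q (halfPow i) t)

  opaque
    E-continuous : ∀ i {c q} → c < E i q → ∃[ q' ] q' < q × c < E i q'
    E-continuous i {c} {q} h with c <? 0ℚ
    ... | yes c<0 = q - 1ℚ , proj₂ (L-inhabited (fromℚ q)) , <-≤-trans c<0 (E-nn i _)
    ... | no c≮0 = go i (≮⇒≥ c≮0) h
      where
      go : ∀ i {c q} → 0ℚ ≤ c → c < E i q → ∃[ q' ] q' < q × c < E i q'
      go zero {c} {q} 0≤c h with E₀-cases q
      ... | inj₁ (e , _) = ⊥-elim (<-irrefl refl (<-≤-trans h (≤-trans (≤-reflexive e) 0≤c)))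
      ... | inj₂ (e , _) with <-dense (subst (c <_) e h)
      ...   | r , cr , rq = r - 1ℚ
          , lt (dif< rq) (solve 2 (λ r q → q :- (r :- con 1ℚ) := con 1ℚ :+ q :- r) refl r q)
          , <-≤-trans cr (≤-trans (≤-reflexive
              (solve 1 (λ r → r := con 1ℚ :+ (r :- con 1ℚ)) refl r)) (p≤q⊔p 0ℚ _))
      go (suc i) {c} {q} 0≤c h with root-below 0≤c E>0 h
        where
        E>0 : 0ℚ < E i (½ * q)
        E>0 with 0ℚ <? E i (½ * q)
        ... | yes k = k
        ... | no ¬k = ⊥-elim (<-irrefl refl (<-≤-trans h (≤-trans
                (≤-reflexive (trans (cong (λ z → z * z) (≤-antisym (≮⇒≥ ¬k) (E-nn i _))) refl)) 0≤c)))
      ... | c' , 0<c' , c'<e , cc with go i (<⇒≤ 0<c') c'<e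
      ...   | q' , q'<q , k = q' + q'
          , lt (+pn (dif< q'<q) (<⇒≤ (dif< q'<q)))
              (solve 2 (λ x q → q :- (x :+ x) := (con ½ :* q :- x) :+ (con ½ :* q :- x)) refl q' q)
          , <-trans cc (subst (λ z → c' * c' < E i z * E i z)
              (solve 1 (λ x → x := con ½ :* (x :+ x)) refl q') (square-< (<⇒≤ 0<c') k))

-- exp q is squeezed between expApprox i q and 1 / expApprox i (- q).
exp : ℚ → ℝ
exp q = record
  { L           = eL
  ; U           = eU
  ; L-inhabited = - 1ℚ , 0 , <-≤-trans (*<* ℤ.-<+) (E-nn 0 q)
  ; U-inhabited = bounded
  ; L-lower     = λ { p<q (i , h) → i , <-trans p<q h }
  ; U-upper     = λ { p<q (i , h) → i , <-≤-trans h
                    (*-monoʳ-≤-nonNeg (E i (- q)) {{nonNegative (E-nn i (- q))}} (<⇒≤ p<q)) }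
  ; L-open      = λ { (i , h) → let r , pr , rq = <-dense h in r , pr , i , rq }
  ; U-open      = λ { (i , h) → let r , rq , k = shrink h in r , rq , i , k }
  ; disjoint    = disj
  ; located     = λ {a} {b} → loc a b
  }
  where
  eL eU : ℚ → Set
  eL a = ∃[ i ] a < expApprox i q
  eU b = ∃[ i ] 1ℚ < b * expApprox i (- q)

  disj : ∀ {a} → eL a → eU a → ⊥
  disj {a} (i , h) (j , k) = <-irrefl refl (<-≤-trans k (≤-trans
    (*-monoʳ-≤-nonNeg (E j (- q)) {{nonNegative (E-nn j (- q))}} (<⇒≤ h))
    (E-inverse-≤′ i j q)))

  bounded : ∃ eU
  bounded with halfPow-small (q * q) 1ℚ 0<1
  ... | i , h = b , i , subst (1ℚ <_) (*-comm G b) (proj₂ big)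
    where
    G = E i (- q)
    FG>0 : 0ℚ < E i q * G
    FG>0 = <-≤-trans (dif< h) (≤-trans
      (≤-reflexive (solve 2 (λ q h → con 1ℚ :- h :* (q :* q) := con 1ℚ :+ (q :- q) :- h :* (q :* q))
        refl q (halfPow i)))
      (E-quotient i q q ≤-refl))
    G>0 : 0ℚ < G
    G>0 with 0ℚ <? G
    ... | yes k = k
    ... | no ¬k = ⊥-elim (<-irrefl (sym (trans (cong (E i q *_)
            (≤-antisym (≮⇒≥ ¬k) (E-nn i (- q)))) (*-zeroʳ (E i q)))) FG>0)
    N = proj₁ (archimedean 1ℚ G G>0)
    b = ℕ→ℚ N
    big : ∃[ n ] 1ℚ < G * b
    big = N , subst (1ℚ <_) (*-comm b G) (proj₂ (archimedean 1ℚ G G>0))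

  loc : ∀ a b → a < b → eL a ⊎ eU b
  loc a b a<b with a <? 0ℚ
  ... | yes a<0 = inj₁ (0 , <-≤-trans a<0 (E-nn 0 q))
  ... | no a≮0 with halfPow-small (q * q * b) (b - a) (dif< a<b)
  ...   | i , h with a <? E i q
  ...     | yes k = inj₁ (i , k)
  ...     | no ¬k = inj₂ (i , *-cancelˡ-<-nonNeg a {{nonNegative 0≤a}} a<abG)
    where
    G = E i (- q)
    0≤a = ≮⇒≥ a≮0
    0≤b = <⇒≤ (≤-<-trans 0≤a a<b)
    aG : 1ℚ + (q - q) - halfPow i * (q * q) ≤ a * G
    aG = ≤-trans (E-quotient i q q ≤-refl)
           (*-monoʳ-≤-nonNeg G {{nonNegative (E-nn i (- q))}} (≮⇒≥ ¬k))
    a<abG : a * 1ℚ < a * (b * G)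
    a<abG = lt (+pn (dif< h) (*nn 0≤b (dif≤ aG)))
      (solve 5 (λ a b q G h → a :* (b :* G) :- a :* con 1ℚ
        := (b :- a :- h :* (q :* q :* b))
        :+ b :* (a :* G :- (con 1ℚ :+ (q :- q) :- h :* (q :* q)))) refl a b q G (halfPow i))

-- The cut given by exp q < x < exp q' .
log : (x : ℝ) → 0ℝ <ℝ x → ℝ
log x (r₀ , 0<r₀ , lr₀) = record
  { L           = λ q → exp q <ℝ x
  ; U           = λ q → x <ℝ exp q
  ; L-inhabited = lower
  ; U-inhabited =
      let s , us = U-inhabited x
      in s , s , us , 0 , <-≤-trans
           (lt 0<1 (solve 1 (λ s → con 1ℚ :+ s :- s := con 1ℚ) refl s)) (p≤q⊔p 0ℚ (1ℚ + s))
  ; L-lower     = λ p<q q∈ → <ℝ-trans (exp _) (exp _) x (exp-< p<q) q∈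
  ; U-upper     = λ p<q p∈ → <ℝ-trans x (exp _) (exp _) p∈ (exp-< p<q)
  ; L-open      = L-op
  ; U-open      = λ { (r , ur , i , h) →
                    let q' , q'<q , k = E-continuous i h in q' , q'<q , r , ur , i , k }
  ; disjoint    = λ {q} l u → <ℝ-irrefl (exp q) (<ℝ-trans (exp q) x (exp q) l u)
  ; located     = loc
  }
  where
  <ℝ-irrefl : ∀ x → x <ℝ x → ⊥
  <ℝ-irrefl x (q , u , l) = disjoint x l u

  <ℝ-trans : ∀ x y z → x <ℝ y → y <ℝ z → x <ℝ z
  <ℝ-trans x y z (p , up , lp) (q , uq , lq) = p , up , L-lower z (L<U y lp uq) lq

  separate : ∀ {p q} → p < q → ∃[ i ] 1ℚ < E i q * E i (- p)
  separate {p} {q} p<q =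
    let i , h = halfPow-small (p * q) (q - p) (dif< p<q)
    in i , <-≤-trans (lt (dif< h)
      (solve 3 (λ p q h → con 1ℚ :+ (q :- p) :- h :* (p :* q) :- con 1ℚ := q :- p :- h :* (p :* q))
        refl p q (halfPow i)))
      (E-quotient i p q (<⇒≤ p<q))

  exp-< : ∀ {p q} → p < q → exp p <ℝ exp q
  exp-< p<q =
    let i , h       = separate p<q
        b , b<F , k = shrink h
    in b , (i , k) , (i , b<F)

  n≤E₀ : ∀ n → n ≤ E 0 (- (- n))
  n≤E₀ n = ≤-trans
    (le {n} {1ℚ + (- (- n))} (<⇒≤ 0<1)
      (solve 1 (λ n → con 1ℚ :+ (:- (:- n)) :- n := con 1ℚ) refl n))
    (p≤q⊔p 0ℚ (1ℚ + (- (- n))))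

  lower : ∃[ q ] exp q <ℝ x
  lower =
    let N , h = archimedean 1ℚ r₀ 0<r₀
    in - ℕ→ℚ N , r₀ , (0 , <-≤-trans h (≤-trans
      (≤-reflexive (*-comm (ℕ→ℚ N) r₀))
      (*-monoˡ-≤-nonNeg r₀ {{nonNegative (<⇒≤ 0<r₀)}} (n≤E₀ (ℕ→ℚ N))))) , lr₀

  L-op : ∀ {q} → exp q <ℝ x → ∃[ q' ] q < q' × exp q' <ℝ x
  L-op {q} (r , (i , h) , lr) =
    let c , c<E , k     = shrink {b = E i (- q)} (subst (1ℚ <_) (*-comm r _) h)
        y , y<-q , c<Ey = E-continuous i c<E
    in - y
      , lt (dif< y<-q) (solve 2 (λ y q → (:- y) :- q := (:- q) :- y) refl y q)
      , r , (i , subst (λ z → 1ℚ < r * E i z) (solve 1 (λ y → y := :- (:- y)) refl y)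
          (<-≤-trans k (≤-trans (≤-reflexive (*-comm c r))
            (*-monoˡ-≤-nonNeg r {{nonNegative (<⇒≤ r>0)}} (<⇒≤ c<Ey)))))
      , lr
    where
    r>0 : 0ℚ < r
    r>0 = pos-factor (E-nn i (- q)) h

  loc : ∀ {p q} → p < q → exp p <ℝ x ⊎ x <ℝ exp q
  loc p<q =
    let i , h       = separate p<q
        b , b<F , k = shrink h
        a , a<b , l = shrink k
    in Sum.map (λ la → a , (i , l) , la) (λ ub → b , ub , (i , b<F)) (located x a<b)

{-# OPTIONS --safe #-}

-- The value n is found by averaging. Let Q be m times the product of the
-- primes p with m + 2 ≤ p ≤ y. For odd p the congruence x² + y² + z² ≡ -1
-- (mod p) has at least p² + p solutions, so by the Chinese remainder theorem
-- some class n₀ ≡ a (mod m) has at least Q² ∏ (1 + 1/p) / m² solutions modulo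
-- Q. Their representatives in the box [Q , 2 Q)³ have sums of squares among
-- 9 Q values n ≡ n₀ (mod Q), hence r₃(n) ≥ Q ∏ (1 + 1/p) / (9 m²) for one of
-- these, while √n ≤ 4 Q. A sieve of the harmonic sum gives ∏ (1 + 1/p) ≫ log y,
-- and log y is of the order of log log Q.
module Submission where

-- The residue -1 is chosen because, for p not dividing n, x² + y² + z² ≡ n (mod p) has p² + (-n/p)
-- p solutions: with n ≡ -1 the symbol is +1 at every odd p at once, so each prime gains a factor 1
-- + 1/p over the expected p².
--
-- Local counts alone bound no single r₃(n) from below; the pigeonhole over the 9 Q admissible
-- values does, at the price of not knowing which n is hit. The class modulo m is carried along as
-- part of Q, and the primes used exceed m + 1, hence are odd and prime to m. Dropping the smaller
-- primes costs a factor depending on m only.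
--
-- The double logarithm forgives crude estimates: bounding the product of the primes up to y by a
-- power y^y instead of e^y changes log log Q by a bounded factor. With t = 2^k and y of size 2^t,
-- logarithms become exponents, and all estimates are inequalities between natural numbers. Real
-- numbers enter only at the end, through s ≥ √n and 2^j ≥ log log n.

module Congruence where
  open import Defs
  open import Data.Nat as ℕ using (ℕ; zero; suc; _<_; s≤s)
  import Data.Nat.Properties as ℕ
  import Data.Nat.Divisibility as ℕ
  open import Data.Nat.Coprimality using (Coprime; coprime-Bézout)
  open import Data.Nat.GCD using (module Bézout)
  open import Data.Nat.Primality using (Prime; euclidsLemma; prime⇒nonTrivial)
  open import Data.Integer as ℤ using (ℤ; +_; _+_; _*_; _-_; -_; 1ℤ)
  import Data.Integer.Properties as ℤ
  open import Data.Integer.DivMod using (_%ℕ_; _/ℕ_; n%ℕd<d; a≡a%ℕn+[a/ℕn]*n)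
  open import Data.Integer.Divisibility.Signed
  open import Data.Integer.Tactic.RingSolver using (solve-∀)
  open import Data.Fin as Fin using (Fin; toℕ; fromℕ<; splitAt; remQuot; combine; join)
  open import Data.Fin.Properties
    using (toℕ<n; toℕ-injective; toℕ-fromℕ<; pigeonhole; splitAt⁻¹-↑ˡ; splitAt⁻¹-↑ʳ;
      join-splitAt; combine-remQuot; <⇒≢)
  open import Data.Product using (Σ-syntax; ∃-syntax; _×_; _,_; uncurry)
  open import Data.Sum using (_⊎_; inj₁; inj₂; map₁)
  open import Data.Empty using (⊥; ⊥-elim)
  open import Relation.Nullary using (¬_; contradiction)
  open import Relation.Binary.PropositionalEquality
    using (_≡_; refl; sym; trans; cong; cong₂; subst)

  -- Congruent triples and the Chinese remainder theorem.

  Triple : Set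
  Triple = ℤ × ℤ × ℤ

  infix 4 _≋_[_]
  _≋_[_] : Triple → Triple → ℕ → Set
  (x , y , z) ≋ (x′ , y′ , z′) [ Q ] = + Q ∣ x - x′ × + Q ∣ y - y′ × + Q ∣ z - z′

  ∣-lin₂ : ∀ {q u v E} k l → q ∣ u → q ∣ v → k * u + l * v ≡ E → q ∣ E
  ∣-lin₂ k l q∣u q∣v refl = ∣m∣n⇒∣m+n (∣n⇒∣m*n k q∣u) (∣n⇒∣m*n l q∣v)

  ∣-lin₃ : ∀ {q u v w E} k l m → q ∣ u → q ∣ v → q ∣ w → k * u + l * v + m * w ≡ E → q ∣ E
  ∣-lin₃ k l m q∣u q∣v q∣w refl = ∣m∣n⇒∣m+n (∣-lin₂ k l q∣u q∣v refl) (∣n⇒∣m*n m q∣w)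

  ∣-telescope : ∀ {q} x y z → q ∣ x - y → q ∣ y - z → q ∣ x - z
  ∣-telescope x y z h k = ∣-lin₂ 1ℤ 1ℤ h k (eq x y z)
    where
    eq : ∀ x y z → 1ℤ * (x - y) + 1ℤ * (y - z) ≡ x - z
    eq = solve-∀

  ≋-trans : ∀ {Q} s t u → s ≋ t [ Q ] → t ≋ u [ Q ] → s ≋ u [ Q ]
  ≋-trans (x , y , z) (x′ , y′ , z′) (x″ , y″ , z″) (a , b , c) (a′ , b′ , c′) =
    ∣-telescope x x′ x″ a a′ , ∣-telescope y y′ y″ b b′ , ∣-telescope z z′ z″ c c′

  ∣-flip : ∀ {q} x y → q ∣ x - y → q ∣ y - x
  ∣-flip x y h = subst (_ ∣_) (flip x y) (∣m⇒∣-m h)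
    where
    flip : ∀ x y → - (x - y) ≡ y - x
    flip = solve-∀

  ≋-sym : ∀ {Q} s t → s ≋ t [ Q ] → t ≋ s [ Q ]
  ≋-sym (x , y , z) (x′ , y′ , z′) (a , b , c) = ∣-flip x x′ a , ∣-flip y y′ b , ∣-flip z z′ c

  ≋-coarsen : ∀ {Q R} s t → + Q ∣ + R → s ≋ t [ R ] → s ≋ t [ Q ]
  ≋-coarsen _ _ Q∣R (a , b , c) = ∣-trans Q∣R a , ∣-trans Q∣R b , ∣-trans Q∣R c

  sumOfSquares-cong : ∀ {Q} s t → s ≋ t [ Q ] → + Q ∣ sumOfSquares s - sumOfSquares t
  sumOfSquares-cong (x , y , z) (x′ , y′ , z′) (a , b , c) =
    ∣-lin₃ (x + x′) (y + y′) (z + z′) a b c (eq x y z x′ y′ z′)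
    where
    eq : ∀ x y z x′ y′ z′ →
      (x + x′) * (x - x′) + (y + y′) * (y - y′) + (z + z′) * (z - z′)
      ≡ (x * x + y * y + z * z) - (x′ * x′ + y′ * y′ + z′ * z′)
    eq = solve-∀

  -- Points are integer representatives rather than elements of a quotient, so that the same triple
  -- can be reduced modulo a divisor of Q or moved into a box.
  record Solutions (Q : ℕ) (n₀ : ℤ) (k : ℕ) : Set where
    field
      point    : Fin k → Triple
      sound    : ∀ i → + Q ∣ sumOfSquares (point i) - n₀
      distinct : ∀ i j → point i ≋ point j [ Q ] → i ≡ j

  remQuot-injective : ∀ {k} l (i j : Fin (k ℕ.* l)) → remQuot {k} l i ≡ remQuot l j → i ≡ j
  remQuot-injective {k} l i j eq =
    trans (sym (combine-remQuot {k} l i)) (trans (cong (uncurry combine) eq) (combine-remQuot {k} l j))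

  -- Bézout: e is the multiple of p in a relation u Q + v p = 1. The two cases are the two possible
  -- signs.
  coprime⇒idempotent : ∀ {Q p} → Coprime Q p → Σ[ e ∈ ℤ ] + Q ∣ 1ℤ - e × + p ∣ e
  coprime⇒idempotent {Q} {p} cop with coprime-Bézout cop
  ... | Bézout.+- x y eq = - (+ y * + p)
      , divides (+ x) (trans (neg-neg (+ y) (+ p)) (trans (cong (λ z → 1ℤ + z) (sym (ℤ.pos-* y p)))
          (trans (cong +_ eq) (ℤ.pos-* x Q))))
      , divides (- (+ y)) (ℤ.neg-distribˡ-* (+ y) (+ p))
    where
    neg-neg : ∀ y p → 1ℤ - (- (y * p)) ≡ 1ℤ + y * p
    neg-neg = solve-∀
  ... | Bézout.-+ x y eq = + y * + p
      , divides (- (+ x)) (trans (cong (λ z → 1ℤ - z) (trans (sym (ℤ.pos-* y p)) (trans (cong +_ (sym eq))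
          (cong (λ z → 1ℤ + z) (ℤ.pos-* x Q))))) (cancel (+ x) (+ Q)))
      , divides (+ y) refl
    where
    cancel : ∀ x q → 1ℤ - (1ℤ + x * q) ≡ - x * q
    cancel = solve-∀

  -- In E = (1 - e) E + e E the factors a and b divide 1 - e and E in the first term, E and e in the
  -- second.
  ∣-product : ∀ {a b} e E → a ∣ 1ℤ - e → b ∣ e → a ∣ E → b ∣ E → a * b ∣ E
  ∣-product {a} {b} e E a∣1-e b∣e a∣E b∣E = subst (a * b ∣_) (split e E)
    (∣m∣n⇒∣m+n (∣-trans (*-monoʳ-∣ a b∣E) (*-monoˡ-∣ E a∣1-e))
               (subst (a * b ∣_) (ℤ.*-comm E e) (∣-trans (*-monoʳ-∣ a b∣e) (*-monoˡ-∣ e a∣E))))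
    where
    split : ∀ e E → (1ℤ - e) * E + e * E ≡ E
    split = solve-∀

  -- The map (s , t) ↦ e s + (1 - e) t is s modulo Q and t modulo p, so an image modulo Q p
  -- determines both indices. That n₂ ≡ n₀ (mod Q) is recorded to preserve the class modulo m.
  combine-solutions : ∀ {Q p n₀ n₁ k l} → Coprime Q p → Solutions Q n₀ k → Solutions p n₁ l →
    Σ[ n₂ ∈ ℤ ] + Q ∣ n₂ - n₀ × Solutions (Q ℕ.* p) n₂ (k ℕ.* l)
  combine-solutions {Q} {p} {n₀} {n₁} {k} {l} cop S T with coprime⇒idempotent cop
  ... | e , Q∣1-e , p∣e = glue n₀ n₁ , glue-Q n₀ n₁ , record
    { point = λ i → pt (remQuot l i)
    ; sound = λ i → subst (_∣ sumOfSquares (pt (remQuot l i)) - glue n₀ n₁) (sym (ℤ.pos-* Q p))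
        (∣-product e _ Q∣1-e p∣e (sound-Q (remQuot l i)) (sound-p (remQuot l i)))
    ; distinct = λ i j h → remQuot-injective {k} l i j (distinct′ (remQuot l i) (remQuot l j) h)
    }
    where
    module S = Solutions S
    module T = Solutions T
    glue : ℤ → ℤ → ℤ
    glue s t = e * s + (1ℤ - e) * t
    glue₃ : Triple → Triple → Triple
    glue₃ (x , y , z) (x′ , y′ , z′) = glue x x′ , glue y y′ , glue z z′
    pt : Fin k × Fin l → Triple
    pt (i , j) = glue₃ (S.point i) (T.point j)
    eqQ : ∀ e s t → (t - s) * (1ℤ - e) ≡ e * s + (1ℤ - e) * t - s
    eqQ = solve-∀
    eqp : ∀ e s t → (s - t) * e ≡ e * s + (1ℤ - e) * t - t
    eqp = solve-∀
    glue-Q : ∀ s t → + Q ∣ glue s t - s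
    glue-Q s t = subst (_ ∣_) (eqQ e s t) (∣n⇒∣m*n (t - s) Q∣1-e)
    glue-p : ∀ s t → + p ∣ glue s t - t
    glue-p s t = subst (_ ∣_) (eqp e s t) (∣n⇒∣m*n (s - t) p∣e)
    glue₃-Q : ∀ s t → glue₃ s t ≋ s [ Q ]
    glue₃-Q (x , y , z) (x′ , y′ , z′) = glue-Q x x′ , glue-Q y y′ , glue-Q z z′
    glue₃-p : ∀ s t → glue₃ s t ≋ t [ p ]
    glue₃-p (x , y , z) (x′ , y′ , z′) = glue-p x x′ , glue-p y y′ , glue-p z z′
    sound-Q : ∀ i → + Q ∣ sumOfSquares (pt i) - glue n₀ n₁
    sound-Q (i , j) = ∣-telescope (sumOfSquares (pt (i , j))) n₀ (glue n₀ n₁)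
      (∣-telescope (sumOfSquares (pt (i , j))) (sumOfSquares (S.point i)) n₀
        (sumOfSquares-cong (pt (i , j)) (S.point i) (glue₃-Q (S.point i) (T.point j)))
        (S.sound i))
      (∣-flip (glue n₀ n₁) n₀ (glue-Q n₀ n₁))
    sound-p : ∀ i → + p ∣ sumOfSquares (pt i) - glue n₀ n₁
    sound-p (i , j) = ∣-telescope (sumOfSquares (pt (i , j))) n₁ (glue n₀ n₁)
      (∣-telescope (sumOfSquares (pt (i , j))) (sumOfSquares (T.point j)) n₁
        (sumOfSquares-cong (pt (i , j)) (T.point j) (glue₃-p (S.point i) (T.point j)))
        (T.sound j))
      (∣-flip (glue n₀ n₁) n₁ (glue-p n₀ n₁))
    Q∣Qp : + Q ∣ + (Q ℕ.* p)
    Q∣Qp = divides (+ p) (trans (ℤ.pos-* Q p) (ℤ.*-comm (+ Q) (+ p)))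
    p∣Qp : + p ∣ + (Q ℕ.* p)
    p∣Qp = divides (+ Q) (ℤ.pos-* Q p)
    distinct′ : ∀ i j → pt i ≋ pt j [ Q ℕ.* p ] → i ≡ j
    distinct′ (i , i′) (j , j′) h = cong₂ _,_
      (S.distinct i j (≋-trans (S.point i) (pt (i , i′)) (S.point j)
        (≋-sym (pt (i , i′)) (S.point i) (glue₃-Q (S.point i) (T.point i′)))
        (≋-trans (pt (i , i′)) (pt (j , j′)) (S.point j)
          (≋-coarsen (pt (i , i′)) (pt (j , j′)) Q∣Qp h) (glue₃-Q (S.point j) (T.point j′)))))
      (T.distinct i′ j′ (≋-trans (T.point i′) (pt (i , i′)) (T.point j′)
        (≋-sym (pt (i , i′)) (T.point i′) (glue₃-p (S.point i) (T.point i′)))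
        (≋-trans (pt (i , i′)) (pt (j , j′)) (T.point j′)
          (≋-coarsen (pt (i , i′)) (pt (j , j′)) p∣Qp h) (glue₃-p (S.point j) (T.point j′)))))

  -- Solutions modulo an odd prime.

  small-multiple : ∀ {p} d → d < p → p ℕ.∣ d → d ≡ 0
  small-multiple zero    _   _   = refl
  small-multiple (suc d) d<p p∣d = contradiction (ℕ.∣⇒≤ p∣d) (ℕ.<⇒≱ d<p)

  small-∣⇒≡ : ∀ {p} i j → i < p → j < p → + p ∣ + i - + j → i ≡ j
  small-∣⇒≡ {p} i j i<p j<p h = ℤ.+-injective (ℤ.i-j≡0⇒i≡j (+ i) (+ j) (ℤ.∣i∣≡0⇒i≡0 (small-multiple _ bound (∣⇒∣ᵤ h))))
    where
    bound : ℤ.∣ + i - + j ∣ < p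
    bound = subst (λ z → ℤ.∣ z ∣ < p) (sym (ℤ.m-n≡m⊖n i j))
      (ℕ.≤-<-trans (ℤ.∣m⊝n∣≤m⊔n i j) (ℕ.⊔-lub i<p j<p))

  residue : ∀ p .{{_ : ℕ.NonZero p}} → ℤ → Fin p
  residue p x = fromℕ< (n%ℕd<d x p)

  residue-≡⇒∣ : ∀ p .{{_ : ℕ.NonZero p}} x y → residue p x ≡ residue p y → + p ∣ x - y
  residue-≡⇒∣ p x y eq = divides (x /ℕ p - y /ℕ p)
    (trans (cong₂ _-_ (a≡a%ℕn+[a/ℕn]*n x p) (a≡a%ℕn+[a/ℕn]*n y p))
      (trans (cong (λ r → + (x %ℕ p) + x /ℕ p * + p - (+ r + y /ℕ p * + p)) (sym rem≡))
        (sub (+ (x %ℕ p)) (x /ℕ p) (y /ℕ p) (+ p))))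
    where
    rem≡ : x %ℕ p ≡ y %ℕ p
    rem≡ = trans (sym (toℕ-fromℕ< (n%ℕd<d x p))) (trans (cong toℕ eq) (toℕ-fromℕ< (n%ℕd<d y p)))
    sub : ∀ r a b p → r + a * p - (r + b * p) ≡ (a - b) * p
    sub = solve-∀

  sq : ℕ → ℤ
  sq i = + i * + i

  -- p divides i - j or i + j, and both are smaller than p in absolute value; i + j = 0 leaves only
  -- i = j = 0.
  half-square-injective : ∀ {h} → Prime (suc (h ℕ.+ h)) → ∀ i j → i ℕ.≤ h → j ℕ.≤ h →
    + suc (h ℕ.+ h) ∣ sq i - sq j → i ≡ j
  half-square-injective {h} p-prime i j i≤h j≤h d
    with euclidsLemma ℤ.∣ + i - + j ∣ (i ℕ.+ j) p-prime
           (subst (_ ℕ.∣_) (trans (cong ℤ.∣_∣ (factor (+ i) (+ j))) (ℤ.abs-* (+ i - + j) (+ i + + j))) (∣⇒∣ᵤ d))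
    where
    factor : ∀ i j → i * i - j * j ≡ (i - j) * (i + j)
    factor = solve-∀
  ... | inj₁ p∣i-j = small-∣⇒≡ i j (le i≤h) (le j≤h) (∣ᵤ⇒∣ p∣i-j)
    where
    le : ∀ {i} → i ℕ.≤ h → i < suc (h ℕ.+ h)
    le i≤h = s≤s (ℕ.≤-trans i≤h (ℕ.m≤m+n h h))
  ... | inj₂ p∣i+j = trans (ℕ.m+n≡0⇒m≡0 i sum≡0) (sym (ℕ.m+n≡0⇒n≡0 i sum≡0))
    where
    sum≡0 : i ℕ.+ j ≡ 0
    sum≡0 = small-multiple (i ℕ.+ j) (s≤s (ℕ.+-mono-≤ i≤h j≤h)) p∣i+j

  -- For 0 ≤ α, β ≤ h the α² and the -(β² + 1) take h + 1 values each modulo p. Together these are 2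
  -- h + 2 > p, so two agree, and a collision within one family is excluded by
  -- `half-square-injective`.
  sumOfTwoSquares≡-1 : ∀ {h} → Prime (suc (h ℕ.+ h)) →
    ∃[ α ] ∃[ β ] + suc (h ℕ.+ h) ∣ α * α + β * β + 1ℤ
  sumOfTwoSquares≡-1 {h} p-prime = found (pigeonhole p<n (λ i → class (splitAt (suc h) i)))
    where
    p = suc (h ℕ.+ h)
    p<n : p < suc h ℕ.+ suc h
    p<n = s≤s (ℕ.≤-reflexive (sym (ℕ.+-suc h h)))
    class : Fin (suc h) ⊎ Fin (suc h) → Fin p
    class (inj₁ i) = residue p (sq (toℕ i))
    class (inj₂ i) = residue p (- (sq (toℕ i) + 1ℤ))
    ≤h : ∀ (i : Fin (suc h)) → toℕ i ℕ.≤ h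
    ≤h i = ℕ.s≤s⁻¹ (toℕ<n i)
    flip : ∀ a b → - (a + 1ℤ) - - (b + 1ℤ) ≡ b - a
    flip = solve-∀
    mixed : ∀ a b → a - - (b + 1ℤ) ≡ a + b + 1ℤ
    mixed = solve-∀
    Found = ∃[ α ] ∃[ β ] + p ∣ α * α + β * β + 1ℤ
    found : ∃[ i ] ∃[ j ] i Fin.< j × class (splitAt (suc h) i) ≡ class (splitAt (suc h) j) → Found
    found (i , j , i<j , eq) with splitAt (suc h) i in ei | splitAt (suc h) j in ej
    ... | inj₁ a | inj₁ b = ⊥-elim (<⇒≢ i<j (trans (sym (splitAt⁻¹-↑ˡ ei)) (trans
        (cong (Fin._↑ˡ suc h) (toℕ-injective (half-square-injective p-prime _ _ (≤h a) (≤h b)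
          (residue-≡⇒∣ p (sq (toℕ a)) (sq (toℕ b)) eq))))
        (splitAt⁻¹-↑ˡ ej))))
    ... | inj₂ a | inj₂ b = ⊥-elim (<⇒≢ i<j (trans (sym (splitAt⁻¹-↑ʳ ei)) (trans
        (cong (suc h Fin.↑ʳ_) (sym (toℕ-injective (half-square-injective p-prime _ _ (≤h b) (≤h a)
          (subst (+ p ∣_) (flip (sq (toℕ a)) (sq (toℕ b)))
            (residue-≡⇒∣ p (- (sq (toℕ a) + 1ℤ)) (- (sq (toℕ b) + 1ℤ)) eq))))))
        (splitAt⁻¹-↑ʳ ej))))
    ... | inj₁ a | inj₂ b = + toℕ a , + toℕ b
        , subst (+ p ∣_) (mixed (sq (toℕ a)) (sq (toℕ b)))
            (residue-≡⇒∣ p (sq (toℕ a)) (- (sq (toℕ b) + 1ℤ)) eq)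
    ... | inj₂ a | inj₁ b = + toℕ b , + toℕ a
        , subst (+ p ∣_) (mixed (sq (toℕ b)) (sq (toℕ a)))
            (residue-≡⇒∣ p (sq (toℕ b)) (- (sq (toℕ a) + 1ℤ)) (sym eq))

  -- The trace-zero matrices [a , h + y ; h - y , - a] of determinant -1 are the
  -- matrices 2 M - 1 with M = [A , B ; C , 1 - A] a rank one idempotent. With
  -- α² + β² = -1 their determinant form becomes a sum of three squares.
  solutions-prime : ∀ {h} → Prime (suc (h ℕ.+ h)) →
    let p = suc (h ℕ.+ h) in Solutions p (- 1ℤ) (p ℕ.* p ℕ.+ p)
  solutions-prime {h} p-prime with sumOfTwoSquares≡-1 {h} p-prime
  ... | α , β , p∣α²+β²+1 = record
    { point    = λ i → pt (decode i)
    ; sound    = λ i → subst (+ p ∣_) (sumsq α β (A (decode i)) (B (decode i)) (C (decode i)))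
        (∣-lin₂ (norm (decode i)) (- (+ 4)) p∣α²+β²+1 (idempotent (decode i)) refl)
    ; distinct = λ i j h → decode-injective i j (point-injective (decode i) (decode j) h)
    }
    where
    p = suc (h ℕ.+ h)
    -- A rank one idempotent is given by its image and a complementary kernel: p + 1 lines times p
    -- complements. `inj₁ (s , r)` has image spanned by (1 , s), `inj₂ r` by (0 , 1); r selects the
    -- kernel.
    Index = (Fin p × Fin p) ⊎ Fin p
    decode : Fin (p ℕ.* p ℕ.+ p) → Index
    decode i = map₁ (remQuot p) (splitAt (p ℕ.* p) i)
    encode : Index → Fin (p ℕ.* p ℕ.+ p)
    encode x = join (p ℕ.* p) p (map₁ (uncurry combine) x)
    encode-decode : ∀ i → encode (decode i) ≡ i
    encode-decode i with splitAt (p ℕ.* p) i | join-splitAt (p ℕ.* p) p i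
    ... | inj₁ k | eq = trans (cong (Fin._↑ˡ p) (combine-remQuot {p} p k)) eq
    ... | inj₂ k | eq = eq
    decode-injective : ∀ i j → decode i ≡ decode j → i ≡ j
    decode-injective i j eq =
      trans (sym (encode-decode i)) (trans (cong encode eq) (encode-decode j))
    [_] : Fin p → ℤ
    [ s ] = + toℕ s
    A B C : Index → ℤ
    A (inj₁ (s , r)) = 1ℤ - [ s ] * [ r ]
    A (inj₂ r)       = ℤ.0ℤ
    B (inj₁ (s , r)) = [ r ]
    B (inj₂ r)       = ℤ.0ℤ
    C (inj₁ (s , r)) = [ s ] * (1ℤ - [ s ] * [ r ])
    C (inj₂ r)       = [ r ]
    pt : Index → Triple
    pt i = α * (A i + A i - 1ℤ) + β * (B i + C i) , B i - C i , β * (A i + A i - 1ℤ) - α * (B i + C i)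
    norm : Index → ℤ
    norm i = (A i + A i - 1ℤ) * (A i + A i - 1ℤ) + (B i + C i) * (B i + C i)
    idempotent : ∀ i → + p ∣ A i * A i - A i + B i * C i
    idempotent (inj₁ (s , r)) = divides ℤ.0ℤ (vanish [ s ] [ r ])
      where
      vanish : ∀ s r → (1ℤ - s * r) * (1ℤ - s * r) - (1ℤ - s * r) + r * (s * (1ℤ - s * r)) ≡ ℤ.0ℤ
      vanish = solve-∀
    idempotent (inj₂ r) = divides ℤ.0ℤ refl
    sumsq : ∀ α β A B C →
      ((A + A - 1ℤ) * (A + A - 1ℤ) + (B + C) * (B + C)) * (α * α + β * β + 1ℤ) + (- (+ 4)) * (A * A - A + B * C)
      ≡ (α * (A + A - 1ℤ) + β * (B + C)) * (α * (A + A - 1ℤ) + β * (B + C))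
        + (B - C) * (B - C)
        + (β * (A + A - 1ℤ) - α * (B + C)) * (β * (A + A - 1ℤ) - α * (B + C)) - (- 1ℤ)
    sumsq = solve-∀
    halve : ∀ u → + p ∣ u + u → + p ∣ u
    halve u d = ∣-lin₂ u (- (+ h)) ∣-refl d (trans (cong (λ z → u * z + (- (+ h)) * (u + u))
      (cong (λ z → 1ℤ + z) (ℤ.pos-+ h h))) (eq u (+ h)))
      where
      eq : ∀ u h → u * (1ℤ + (h + h)) + (- h) * (u + u) ≡ u
      eq = solve-∀
    -- The map (u , v) ↦ (α u + β v , β u - α v) squares to α² + β² ≡ -1, so its negative inverts it
    -- and recovers 2 A - 1 and B + C; 2 is invertible as p is odd.
    matrix : ∀ i j → pt i ≋ pt j [ p ] → + p ∣ A i - A j × + p ∣ B i - B j × + p ∣ C i - C j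
    matrix i j (dx , dy , dz) =
        halve _ (∣-lin₃ (A i + A i - (A j + A j)) (- α) (- β) p∣α²+β²+1 dx dz (eqA α β (A i) (B i) (C i) (A j) (B j) (C j)))
      , halve _ (∣-lin₂ 1ℤ 1ℤ dh dy (eqB (B i) (C i) (B j) (C j)))
      , halve _ (∣-lin₂ 1ℤ (- 1ℤ) dh dy (eqC (B i) (C i) (B j) (C j)))
      where
      eqA : ∀ α β A B C A′ B′ C′ →
        (A + A - (A′ + A′)) * (α * α + β * β + 1ℤ)
        + (- α) * (α * (A + A - 1ℤ) + β * (B + C) - (α * (A′ + A′ - 1ℤ) + β * (B′ + C′)))
        + (- β) * (β * (A + A - 1ℤ) - α * (B + C) - (β * (A′ + A′ - 1ℤ) - α * (B′ + C′)))
        ≡ (A - A′) + (A - A′)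
      eqA = solve-∀
      eqH : ∀ α β A B C A′ B′ C′ →
        (B + C - (B′ + C′)) * (α * α + β * β + 1ℤ)
        + (- β) * (α * (A + A - 1ℤ) + β * (B + C) - (α * (A′ + A′ - 1ℤ) + β * (B′ + C′)))
        + α * (β * (A + A - 1ℤ) - α * (B + C) - (β * (A′ + A′ - 1ℤ) - α * (B′ + C′)))
        ≡ B + C - (B′ + C′)
      eqH = solve-∀
      eqB : ∀ B C B′ C′ → 1ℤ * (B + C - (B′ + C′)) + 1ℤ * (B - C - (B′ - C′)) ≡ (B - B′) + (B - B′)
      eqB = solve-∀
      eqC : ∀ B C B′ C′ → 1ℤ * (B + C - (B′ + C′)) + (- 1ℤ) * (B - C - (B′ - C′)) ≡ (C - C′) + (C - C′)
      eqC = solve-∀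
      dh : + p ∣ B i + C i - (B j + C j)
      dh = ∣-lin₃ (B i + C i - (B j + C j)) (- β) α p∣α²+β²+1 dx dz (eqH α β (A i) (B i) (C i) (A j) (B j) (C j))
    fin-≡ : ∀ (s t : Fin p) → + p ∣ [ s ] - [ t ] → s ≡ t
    fin-≡ s t d = toℕ-injective (small-∣⇒≡ _ _ (toℕ<n s) (toℕ<n t) d)
    clash : ∀ s r → + p ∣ 1ℤ - [ s ] * [ r ] → + p ∣ [ r ] → ⊥
    clash s r dA dB = contradiction (∣⇒∣ᵤ (∣-lin₂ 1ℤ [ s ] dA dB (eq [ s ] [ r ]))) p∤1
      where
      eq : ∀ s r → 1ℤ * (1ℤ - s * r) + s * r ≡ 1ℤ
      eq = solve-∀
      p∤1 : ¬ (p ℕ.∣ 1)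
      p∤1 d = ℕ.≤⇒≯ (ℕ.∣⇒≤ d) (ℕ.nonTrivial⇒n>1 p {{prime⇒nonTrivial p-prime}})
    minus-zero : ∀ x → x - ℤ.0ℤ ≡ x
    minus-zero = solve-∀
    entries-injective : ∀ i j →
      + p ∣ A i - A j → + p ∣ B i - B j → + p ∣ C i - C j → i ≡ j
    entries-injective (inj₁ (s , r)) (inj₁ (s′ , r′)) dA dB dC = cong₂ (λ s r → inj₁ (s , r))
      (fin-≡ s s′ (∣-lin₃ (- ([ s ] + [ s′ ])) (- ([ s ] * [ s′ ])) 1ℤ dA dB dC
        (eq [ s ] [ r ] [ s′ ] [ r′ ])))
      (fin-≡ r r′ dB)
      where
      eq : ∀ s r s′ r′ →
        (- (s + s′)) * (1ℤ - s * r - (1ℤ - s′ * r′)) + (- (s * s′)) * (r - r′)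
        + 1ℤ * (s * (1ℤ - s * r) - s′ * (1ℤ - s′ * r′)) ≡ s - s′
      eq = solve-∀
    entries-injective (inj₁ (s , r)) (inj₂ r′) dA dB dC =
      ⊥-elim (clash s r (subst (+ p ∣_) (minus-zero (A (inj₁ (s , r)))) dA)
        (subst (+ p ∣_) (minus-zero [ r ]) dB))
    entries-injective (inj₂ r) (inj₁ (s′ , r′)) dA dB dC =
      ⊥-elim (clash s′ r′
        (subst (+ p ∣_) (minus-zero (A (inj₁ (s′ , r′)))) (∣-flip (A (inj₂ r)) (A (inj₁ (s′ , r′))) dA))
        (subst (+ p ∣_) (minus-zero [ r′ ]) (∣-flip (B (inj₂ r)) [ r′ ] dB)))
    entries-injective (inj₂ r) (inj₂ r′) dA dB dC = cong inj₂ (fin-≡ r r′ dC)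
    point-injective : ∀ i j → pt i ≋ pt j [ p ] → i ≡ j
    point-injective i j h = let dA , dB , dC = matrix i j h in entries-injective i j dA dB dC

-- A sieve of the harmonic sum.

module Sieve where
  open import Data.Nat
  open import Data.Nat.Properties
  open import Data.Nat.Divisibility
  open import Data.Nat.DivMod using (_/_; m/n*n≡m)
  open import Data.Nat.Primality
    using (Prime; prime?; ¬prime⇒composite; euclidsLemma; prime⇒nonTrivial)
  open import Data.Nat.Tactic.RingSolver using (solve-∀)
  open import Data.Sum using (inj₁; inj₂)
  open import Relation.Nullary using (Dec; ¬_; contradiction; yes; no)
  open import Relation.Binary.PropositionalEquality
    using (_≡_; refl; sym; trans; cong; subst)

  infix 0 if_then_else_
  if_then_else_ : ∀ {a} {A : Set a} → Dec A → ℕ → ℕ → ℕ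
  if yes _ then x else y = x
  if no _  then x else y = y

  sum : ℕ → (ℕ → ℕ) → ℕ
  sum zero    f = 0
  sum (suc n) f = sum n f + f n

  sum-mono-≤ : ∀ n {f g} → (∀ k → k < n → f k ≤ g k) → sum n f ≤ sum n g
  sum-mono-≤ zero    h = z≤n
  sum-mono-≤ (suc n) h = +-mono-≤ (sum-mono-≤ n (λ k k<n → h k (m<n⇒m<1+n k<n))) (h n ≤-refl)

  sum-monoˡ-≤ : ∀ {m n} f → m ≤ n → sum m f ≤ sum n f
  sum-monoˡ-≤ {m} f m≤n = go (≤⇒≤′ m≤n)
    where
    go : ∀ {n} → m ≤′ n → sum m f ≤ sum n f
    go ≤′-refl     = ≤-refl
    go (≤′-step h) = ≤-trans (go h) (m≤m+n _ _)

  sum-+ : ∀ n f g → sum n (λ k → f k + g k) ≡ sum n f + sum n g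
  sum-+ zero    f g = refl
  sum-+ (suc n) f g = trans (cong (_+ (f n + g n)) (sum-+ n f g)) (eq (sum n f) (sum n g) (f n) (g n))
    where
    eq : ∀ a b c d → (a + b) + (c + d) ≡ (a + c) + (b + d)
    eq = solve-∀

  *-sum : ∀ c n f → sum n (λ k → c * f k) ≡ c * sum n f
  *-sum c zero    f = sym (*-zeroʳ c)
  *-sum c (suc n) f = trans (cong (_+ c * f n) (*-sum c n f)) (sym (*-distribˡ-+ c (sum n f) (f n)))

  sum-multiples-≤ : ∀ q {f g} .{{_ : NonZero q}} → ∀ n l → n ≤ q * l →
    (∀ k → ¬ q ∣ k → f k ≡ 0) → (∀ k → q * k < n → f (q * k) ≤ g k) → sum n f ≤ sum l g
  sum-multiples-≤ q zero l n≤ql off on = z≤n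
  sum-multiples-≤ q {f} {g} (suc n) l n<ql off on with q ∣? n
  ... | no q∤n = ≤-trans (≤-reflexive (trans (cong (sum n f +_) (off n q∤n)) (+-identityʳ _)))
      (sum-multiples-≤ q n l (<⇒≤ n<ql) off (λ k h → on k (m<n⇒m<1+n h)))
  ... | yes (divides i n≡iq) = ≤-trans
      (+-mono-≤ (sum-multiples-≤ q n i (≤-reflexive n≡qi) off (λ k h → on k (m<n⇒m<1+n h)))
        (subst (λ z → f z ≤ g i) (sym n≡qi) (on i (s≤s (≤-reflexive (sym n≡qi))))))
      (sum-monoˡ-≤ g (*-cancelˡ-< q i l (subst (_< q * l) n≡qi n<ql)))
    where
    n≡qi : n ≡ q * i
    n≡qi = trans n≡iq (*-comm i q)

  -- w with the multiples of 2, …, i + 1 removed.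
  sift : (ℕ → ℕ) → ℕ → ℕ → ℕ
  sift w zero    k = w k
  sift w (suc i) k = if 2+ i ∣? k then 0 else sift w i k

  sift-≤ : ∀ w i k → sift w i k ≤ w k
  sift-≤ w zero    k = ≤-refl
  sift-≤ w (suc i) k with 2+ i ∣? k
  ... | yes _ = z≤n
  ... | no _  = sift-≤ w i k

  -- A divisor of k divides c k, so c k is removed whenever k is.
  sift-multiple : ∀ w i c k → c * w (c * k) ≤ w k → c * sift w i (c * k) ≤ sift w i k
  sift-multiple w zero    c k h = h
  sift-multiple w (suc i) c k h with 2+ i ∣? c * k | 2+ i ∣? k
  ... | yes _    | _      = ≤-trans (≤-reflexive (*-zeroʳ c)) z≤n
  ... | no ¬d∣ck | yes d∣k = contradiction (∣n⇒∣m*n c d∣k) ¬d∣ck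
  ... | no _     | no _   = sift-multiple w i c k h

  sift-removed : ∀ w i d k → 2 ≤ d → d ≤ suc i → d ∣ k → sift w i k ≡ 0
  sift-removed w zero    d k 2≤d d≤1 _ = contradiction d≤1 (<⇒≱ 2≤d)
  sift-removed w (suc i) d k 2≤d d≤ d∣k with 2+ i ∣? k | m≤n⇒m<n∨m≡n d≤
  ... | yes _  | _             = refl
  ... | no ¬e∣k | inj₁ (s≤s d≤′) = sift-removed w i d k 2≤d d≤′ d∣k
  ... | no ¬e∣k | inj₂ refl     = contradiction d∣k ¬e∣k

  -- The multiples of a composite modulus have already gone with those of a proper divisor.
  sift-composite : ∀ w i k → ¬ Prime (2+ i) → sift w i k ≤ sift w (suc i) k
  sift-composite w i k ¬prime with 2+ i ∣? k
  ... | no _ = ≤-refl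
  ... | yes q∣k with ¬prime⇒composite ¬prime
  ...   | hasNonTrivialDivisor d<q d∣q = ≤-reflexive
      (sift-removed w i _ k (nonTrivial⇒n>1 _) (s≤s⁻¹ d<q) (∣-trans d∣q q∣k))

  module _ (w : ℕ → ℕ) (N : ℕ) (scale : ∀ c k .{{_ : NonZero c}} → c * k < N → c * w (c * k) ≤ w k) where

    private
      sifted : ℕ → ℕ
      sifted i = sum N (sift w i)

    -- With q = i + 2, the surviving multiples of q carry at most 1/q of the total: q k has at most
    -- 1/q of the weight of k, and k survives if q k does. Removing them leaves at least the
    -- fraction 1 - 1/q.
    sifted-step : ∀ i → suc i * sifted i ≤ 2+ i * sifted (suc i)
    sifted-step i = +-cancelˡ-≤ (sifted i) _ _ (begin
      2+ i * sifted i                              ≡⟨ *-sum q N (sift w i) ⟨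
      sum N (λ k → q * sift w i k)                 ≤⟨ sum-mono-≤ N (λ k _ → split k) ⟩
      sum N (λ k → q * sift w (suc i) k + multiple k) ≡⟨ sum-+ N _ multiple ⟩
      sum N (λ k → q * sift w (suc i) k) + sum N multiple
        ≤⟨ +-mono-≤ (≤-reflexive (*-sum q N _)) (sum-multiples-≤ q N N (m≤m+n N (suc i * N)) off on) ⟩
      q * sifted (suc i) + sifted i                ≡⟨ +-comm (q * sifted (suc i)) _ ⟩
      sifted i + q * sifted (suc i)                ∎)
      where
      open ≤-Reasoning
      q = 2+ i
      multiple : ℕ → ℕ
      multiple k = if q ∣? k then q * sift w i k else 0
      split : ∀ k → q * sift w i k ≤ q * sift w (suc i) k + multiple k
      split k with q ∣? k
      ... | yes _ = m≤n+m _ (q * 0)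
      ... | no _  = m≤m+n _ 0
      off : ∀ k → ¬ q ∣ k → multiple k ≡ 0
      off k q∤k with q ∣? k
      ... | yes q∣k = contradiction q∣k q∤k
      ... | no _    = refl
      on : ∀ k → q * k < N → multiple (q * k) ≤ sift w i k
      on k qk<N with q ∣? q * k
      ... | yes _ = sift-multiple w i q k (scale q k qk<N)
      ... | no _  = z≤n

    -- The factors q / (q - 1) over all integers 2 ≤ q ≤ i + 1 telescope to i + 1. This is the cost
    -- of the small moduli, whose primes do not enter the products below.
    sifted-base : ∀ i → sifted 0 ≤ suc i * sifted i
    sifted-base zero    = ≤-reflexive (sym (*-identityˡ _))
    sifted-base (suc i) = ≤-trans (sifted-base i) (sifted-step i)

  module _ (b : ℕ) where

    -- The products run over the primes b + 2 ≤ p ≤ b + i + 1.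
    Πp Π[p+1] : ℕ → ℕ
    Πp zero        = 1
    Πp (suc i)     = if prime? (2+ (b + i)) then Πp i * 2+ (b + i) else Πp i
    Π[p+1] zero    = 1
    Π[p+1] (suc i) = if prime? (2+ (b + i)) then Π[p+1] i * suc (2+ (b + i)) else Π[p+1] i

    Πp>0 : ∀ i → 0 < Πp i
    Πp>0 zero = s≤s z≤n
    Πp>0 (suc i) with prime? (2+ (b + i))
    ... | yes _ = *-mono-≤ (Πp>0 i) (s≤s z≤n)
    ... | no _  = Πp>0 i

    Πp≤ : ∀ i Y → b + i < Y → Πp i ≤ Y ^ i
    Πp≤ zero Y _ = ≤-refl
    Πp≤ (suc i) Y h with prime? (2+ (b + i)) | subst (_< Y) (+-suc b i) h
    ... | yes _ | h′ = ≤-trans (*-mono-≤ (Πp≤ i Y (<-trans ≤-refl h′)) h′) (≤-reflexive (*-comm (Y ^ i) Y))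
    ... | no _  | h′ = ≤-trans (Πp≤ i Y (<-trans ≤-refl h′)) (m≤n*m (Y ^ i) Y {{>-nonZero (≤-trans (s≤s z≤n) h)}})

    -- From p + 1 ≤ p². Crude, but enough to turn `mertens` into a lower bound for `Πp`.
    Π[p+1]≤ : ∀ i → Π[p+1] i ≤ Πp i * Πp i
    Π[p+1]≤ zero = ≤-refl
    Π[p+1]≤ (suc i) with prime? (2+ (b + i))
    ... | yes _ = ≤-trans (*-mono-≤ (Π[p+1]≤ i) (bound (b + i))) (≤-reflexive (eq (Πp i) (2+ (b + i))))
      where
      bound : ∀ j → suc (2+ j) ≤ 2+ j * 2+ j
      bound j = ≤-trans (m≤m+n _ _) (≤-reflexive (sym (eq′ j)))
        where
        eq′ : ∀ j → (2 + j) * (2 + j) ≡ (3 + j) + (1 + 3 * j + j * j)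
        eq′ = solve-∀
      eq : ∀ P q → P * P * (q * q) ≡ P * q * (P * q)
      eq = solve-∀
    ... | no _ = Π[p+1]≤ i

    Πp-∤ : ∀ i p → Prime p → b + i < p ∸ 1 → ¬ p ∣ Πp i
    Πp-∤ zero p p-prime _ p∣1 = <⇒≱ (nonTrivial⇒n>1 p {{prime⇒nonTrivial p-prime}}) (∣⇒≤ p∣1)
    Πp-∤ (suc i) p p-prime h p∣Π with prime? (2+ (b + i)) | subst (_< p ∸ 1) (+-suc b i) h
    ... | no _  | h′ = Πp-∤ i p p-prime (<-trans ≤-refl h′) p∣Π
    ... | yes _ | h′ with euclidsLemma (Πp i) (2+ (b + i)) p-prime p∣Π
    ...   | inj₁ d = Πp-∤ i p p-prime (<-trans ≤-refl h′) d
    ...   | inj₂ d = <⇒≱ h′ (≤-trans (∸-monoˡ-≤ 1 (∣⇒≤ d)) ≤-refl)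

    module _ (w : ℕ → ℕ) (N : ℕ) (scale : ∀ c k .{{_ : NonZero c}} → c * k < N → c * w (c * k) ≤ w k) where

      private
        W : ℕ → ℕ
        W i = sum N (sift w i)

      -- The factor (b + i + 1) / (b + i + 2) telescopes the product of the
      -- 1 - 1/k², which absorbs the passage from 1 / (1 - 1/p) to 1 + 1/p.
      sieve : ∀ i → 2+ (b + i) * (W 0 * Πp i) ≤ suc (b + i) * (W (b + i) * Π[p+1] i * 2+ b)
      sieve zero rewrite +-identityʳ b = ≤-trans
        (*-monoʳ-≤ (2+ b) (*-monoˡ-≤ 1 (sifted-base w N scale b)))
        (≤-reflexive (eq b (W b)))
        where
        eq : ∀ b x → (2 + b) * ((1 + b) * x * 1) ≡ (1 + b) * (x * 1 * (2 + b))
        eq = solve-∀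
      sieve (suc i) rewrite +-suc b i with prime? (2+ (b + i)) | sieve i
      ... | yes _ | ih = *-cancelˡ-≤ (2+ s) (begin
          2+ s * (suc (2+ s) * (W 0 * (Πp i * 2+ s)))
            ≡⟨ eq₁ s (W 0) (Πp i) ⟩
          suc (2+ s) * 2+ s * (2+ s * (W 0 * Πp i))
            ≤⟨ *-monoʳ-≤ (suc (2+ s) * 2+ s) ih ⟩
          suc (2+ s) * 2+ s * (suc s * (W s * Π[p+1] i * 2+ b))
            ≡⟨ eq₂ s b (W s) (Π[p+1] i) ⟩
          suc s * W s * (suc (2+ s) * 2+ s * (Π[p+1] i * 2+ b))
            ≤⟨ *-monoˡ-≤ _ (sifted-step w N scale s) ⟩
          2+ s * W (suc s) * (suc (2+ s) * 2+ s * (Π[p+1] i * 2+ b))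
            ≡⟨ eq₃ s b (W (suc s)) (Π[p+1] i) ⟩
          2+ s * (2+ s * (W (suc s) * (Π[p+1] i * suc (2+ s)) * 2+ b)) ∎)
        where
        open ≤-Reasoning
        s = b + i
        eq₁ : ∀ s x y → (2 + s) * ((3 + s) * (x * (y * (2 + s)))) ≡ (3 + s) * (2 + s) * ((2 + s) * (x * y))
        eq₁ = solve-∀
        eq₂ : ∀ s b x y → (3 + s) * (2 + s) * ((1 + s) * (x * y * (2 + b))) ≡ (1 + s) * x * ((3 + s) * (2 + s) * (y * (2 + b)))
        eq₂ = solve-∀
        eq₃ : ∀ s b x y → (2 + s) * x * ((3 + s) * (2 + s) * (y * (2 + b))) ≡ (2 + s) * ((2 + s) * (x * (y * (3 + s)) * (2 + b)))
        eq₃ = solve-∀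
      ... | no ¬p | ih = *-cancelˡ-≤ (2+ s) (begin
          2+ s * (suc (2+ s) * A)       ≡⟨ eq₁ s A ⟩
          suc (2+ s) * (2+ s * A)       ≤⟨ *-monoʳ-≤ (suc (2+ s)) ih ⟩
          suc (2+ s) * (suc s * X)      ≡⟨ *-assoc (suc (2+ s)) (suc s) X ⟨
          suc (2+ s) * suc s * X        ≤⟨ *-mono-≤ (≤-trans (n≤1+n _) (≤-reflexive (eq₂ s))) X≤X′ ⟩
          2+ s * 2+ s * X′              ≡⟨ *-assoc (2+ s) (2+ s) X′ ⟩
          2+ s * (2+ s * X′)            ∎)
        where
        open ≤-Reasoning
        s = b + i
        A = W 0 * Πp i
        X = W s * Π[p+1] i * 2+ b
        X′ = W (suc s) * Π[p+1] i * 2+ b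
        X≤X′ : X ≤ X′
        X≤X′ = *-monoˡ-≤ (2+ b) (*-monoˡ-≤ (Π[p+1] i) (sum-mono-≤ N (λ k _ → sift-composite w s k ¬p)))
        eq₁ : ∀ s a → (2 + s) * ((3 + s) * a) ≡ (3 + s) * ((2 + s) * a)
        eq₁ = solve-∀
        eq₂ : ∀ s → 1 + (3 + s) * (1 + s) ≡ (2 + s) * (2 + s)
        eq₂ = solve-∀

  -- Harmonic weights and a lower Mertens bound.

  module _ (N : ℕ) where

    -- 1/k scaled by N! to stay in ℕ. The value 0 discards the index 0, a multiple of every modulus.
    weight : ℕ → ℕ
    weight zero    = 0
    weight (suc k) = N ! / suc k

    *-weight : ∀ k → 0 < k → k ≤ N → k * weight k ≡ N !
    *-weight (suc k) _ k<N = trans (*-comm (suc k) _)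
      (m/n*n≡m (∣-trans (m∣m*n (k !)) (m≤n⇒m!∣n! k<N)))

    weight-scale : ∀ c k .{{_ : NonZero c}} → c * k < N → c * weight (c * k) ≤ weight k
    weight-scale c zero h = ≤-reflexive (trans (cong (λ z → c * weight z) (*-zeroʳ c)) (*-zeroʳ c))
    weight-scale c (suc k) h = ≤-reflexive (*-cancelˡ-≡ _ _ (suc k)
      (trans (eq c (suc k) (weight (c * suc k)))
        (trans (*-weight (c * suc k) (*-mono-≤ (>-nonZero⁻¹ c) (s≤s z≤n)) (<⇒≤ h))
          (sym (*-weight (suc k) (s≤s z≤n) (≤-trans (m≤n*m (suc k) c) (<⇒≤ h)))))))
      where
      eq : ∀ c k w → k * (c * w) ≡ c * k * w
      eq = solve-∀

    -- Each k with 2 ≤ k < N is itself one of the moduli, so only k = 1, of weight N!, is left.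
    sifted-all : ∀ i → N ≤ i → sum N (sift weight i) ≤ N !
    sifted-all i N≤i = go N ≤-refl
      where
      vanish : ∀ k → 2 ≤ k → k < N → sift weight i k ≡ 0
      vanish k 2≤k k<N = sift-removed weight i k k 2≤k (≤-trans (<⇒≤ k<N) (≤-trans N≤i (n≤1+n i))) ∣-refl
      vanish₀ : ∀ i → sift weight i 0 ≡ 0
      vanish₀ zero    = refl
      vanish₀ (suc i) = refl
      go : ∀ n → n ≤ N → sum n (sift weight i) ≤ N !
      go zero _ = z≤n
      go 1 _ = ≤-trans (≤-reflexive (vanish₀ i)) z≤n
      go 2 2≤N = ≤-trans (+-mono-≤ (≤-reflexive (vanish₀ i)) (sift-≤ weight i 1))
        (≤-trans (≤-reflexive (sym (*-identityˡ _))) (≤-reflexive (*-weight 1 (s≤s z≤n) (<⇒≤ 2≤N))))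
      go (suc (suc (suc n))) n<N = ≤-trans
        (≤-reflexive (trans (cong (sum (2+ n) (sift weight i) +_) (vanish (2+ n) (s≤s (s≤s z≤n)) n<N)) (+-identityʳ _)))
        (go (2+ n) (<⇒≤ n<N))

    -- Each k with s ≤ k < n + s is at most 2 s, so its weight is at least N! / (2 s). Full dyadic
    -- blocks thus add 1/2 each in `harmonic`.
    harmonic-block : ∀ s n → n ≤ s → s + s ≤ N → 0 < s →
      (s + s) * sum s weight + n * N ! ≤ (s + s) * sum (n + s) weight
    harmonic-block s zero    n≤s ss≤N s>0 = ≤-reflexive (+-identityʳ _)
    harmonic-block s (suc n) n≤s ss≤N s>0 = begin
      (s + s) * sum s weight + (N ! + n * N !)       ≡⟨ eq ((s + s) * sum s weight) (N !) (n * N !) ⟩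
      ((s + s) * sum s weight + n * N !) + N !       ≤⟨ +-mono-≤ (harmonic-block s n (<⇒≤ n≤s) ss≤N s>0) last ⟩
      (s + s) * sum (n + s) weight + (s + s) * weight (n + s) ≡⟨ *-distribˡ-+ (s + s) _ (weight (n + s)) ⟨
      (s + s) * sum (suc n + s) weight               ∎
      where
      open ≤-Reasoning
      eq : ∀ a b c → a + (b + c) ≡ (a + c) + b
      eq = solve-∀
      last : N ! ≤ (s + s) * weight (n + s)
      last = ≤-trans (≤-reflexive (sym (*-weight (n + s) (≤-trans s>0 (m≤n+m s n))
               (≤-trans (+-monoˡ-≤ s (<⇒≤ n≤s)) ss≤N))))
             (*-monoˡ-≤ (weight (n + s)) (+-monoˡ-≤ s (<⇒≤ n≤s)))

    harmonic : ∀ t → 2 ^ t ≤ N → t * N ! ≤ 2 * sum (2 ^ t) weight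
    harmonic zero    _ = z≤n
    harmonic (suc t) h = *-cancelˡ-≤ (2 ^ t) {{m^n≢0 2 t}} (begin
      s * (N ! + t * N !)                    ≤⟨ *-monoʳ-≤ s (+-monoʳ-≤ (N !) (harmonic t (≤-trans (m≤m+n s s) ss≤N))) ⟩
      s * (N ! + 2 * sum s weight)           ≡⟨ eq s (N !) (sum s weight) ⟩
      (s + s) * sum s weight + s * N !       ≤⟨ harmonic-block s s ≤-refl ss≤N (m^n>0 2 t) ⟩
      (s + s) * sum (s + s) weight           ≡⟨ eq′ s (sum (s + s) weight) ⟩
      s * (2 * sum (s + s) weight)           ≡⟨ cong (λ z → s * (2 * sum z weight)) (sym double) ⟩
      s * (2 * sum (2 * s) weight)           ∎)
      where
      open ≤-Reasoning
      s = 2 ^ t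
      double : 2 * s ≡ s + s
      double = cong (s +_) (+-identityʳ s)
      ss≤N : s + s ≤ N
      ss≤N = subst (_≤ N) double h
      eq : ∀ s a b → s * (a + 2 * b) ≡ (s + s) * b + s * a
      eq = solve-∀
      eq′ : ∀ s a → (s + s) * a ≡ s * (2 * a)
      eq′ = solve-∀

  -- The harmonic sum starts at t/2 or more and is sieved down to at most 1, while by `sieve` it
  -- loses at most the factor (b + 2) ∏ (1 + 1/p). Here t is the binary logarithm of the length of
  -- the range of primes.
  mertens : ∀ b t → t * Πp b (2 ^ t) ≤ 2 * (Π[p+1] b (2 ^ t) * 2+ b)
  mertens b t = *-cancelˡ-≤ (N !) {{N !≢0}} (begin
      N ! * (t * P)                  ≡⟨ eq₁ (N !) t P ⟩
      t * N ! * P                    ≤⟨ *-monoˡ-≤ P (harmonic N t ≤-refl) ⟩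
      2 * sum N (weight N) * P       ≡⟨ *-assoc 2 (sum N (weight N)) P ⟩
      2 * (sum N (weight N) * P)     ≤⟨ *-monoʳ-≤ 2 strip ⟩
      2 * (W (b + N) * R * 2+ b)     ≤⟨ *-monoʳ-≤ 2 (*-monoˡ-≤ (2+ b) (*-monoˡ-≤ R (sifted-all N (b + N) (m≤n+m N b)))) ⟩
      2 * (N ! * R * 2+ b)           ≡⟨ eq₂ (N !) R (2+ b) ⟩
      N ! * (2 * (R * 2+ b))         ∎)
    where
    open ≤-Reasoning
    N = 2 ^ t
    P = Πp b N
    R = Π[p+1] b N
    W : ℕ → ℕ
    W i = sum N (sift (weight N) i)
    strip : W 0 * P ≤ W (b + N) * R * 2+ b
    strip = *-cancelˡ-≤ (2+ (b + N)) (≤-trans (sieve b (weight N) N (weight-scale N) N)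
      (*-monoˡ-≤ (W (b + N) * R * 2+ b) (n≤1+n (suc (b + N)))))
    eq₁ : ∀ a t p → a * (t * p) ≡ t * a * p
    eq₁ = solve-∀
    eq₂ : ∀ a r m → 2 * (a * r * m) ≡ a * (2 * (r * m))
    eq₂ = solve-∀

-- Choice and size of the parameters.

module Estimates where
  open Sieve
  open import Data.Nat
  open import Data.Nat.Properties
  open import Data.Nat.Tactic.RingSolver using (solve-∀)
  open import Relation.Binary.PropositionalEquality using (_≡_; sym; trans; cong; cong₂)
  open import Relation.Nullary using (contradiction)

  n<2^n : ∀ n → n < 2 ^ n
  n<2^n zero    = s≤s z≤n
  n<2^n (suc n) = <-≤-trans (s≤s (n<2^n n)) (≤-trans (+-monoˡ-≤ (2 ^ n) (m^n>0 2 n))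
    (≤-reflexive (cong (λ z → 2 ^ n + z) (sym (+-identityʳ (2 ^ n))))))

  exponent-≤ : ∀ {t T} → t < T → 2 ≤ T → t + (suc t * T + suc t * T) ≤ T * T * (T * T)
  exponent-≤ {t} {T} t<T 2≤T = begin
    t + (suc t * T + suc t * T)
      ≤⟨ +-mono-≤ (≤-trans (<⇒≤ t<T) (m≤m*n T T {{>-nonZero (≤-trans (s≤s z≤n) 2≤T)}}))
           (+-mono-≤ (*-monoˡ-≤ T t<T) (*-monoˡ-≤ T t<T)) ⟩
    T * T + (T * T + T * T)   ≤⟨ m≤n+m _ (T * T) ⟩
    T * T + (T * T + (T * T + T * T)) ≡⟨ eq T ⟩
    T * T * (2 * 2)           ≤⟨ *-monoʳ-≤ (T * T) (*-mono-≤ 2≤T 2≤T) ⟩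
    T * T * (T * T)           ∎
    where
    open ≤-Reasoning
    eq : ∀ T → T * T + (T * T + (T * T + T * T)) ≡ T * T * (2 * 2)
    eq = solve-∀

  fourth-power : ∀ t → 2 ^ t * 2 ^ t * (2 ^ t * 2 ^ t) ≡ 2 ^ (2 * (2 * t))
  fourth-power t = trans (cong₂ _*_ (sym (^-distribˡ-+-* 2 t t)) (sym (^-distribˡ-+-* 2 t t)))
    (trans (sym (^-distribˡ-+-* 2 (t + t) (t + t))) (cong (2 ^_) (eq t)))
    where
    eq : ∀ t → t + t + (t + t) ≡ 2 * (2 * t)
    eq = solve-∀

  module _ (m k : ℕ) where

    private
      t T P R : ℕ
      t = 2 ^ k
      T = 2 ^ t
      P = Πp m T
      R = Π[p+1] m T

    t<T : t < T
    t<T = n<2^n t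

    -- The at most T factors of P are at most 2 T = 2^(t + 1), so the exponent of 2 is at most t + 2
    -- (t + 1) T ≤ T⁴, and T⁴ = 2^(4 t) with 4 t = 2^(2 + k).
    Πp²-≤ : ∀ {c} → m ≤ t → c ≤ t → c * (P * P) ≤ 2 ^ (2 ^ (2 ^ (2 + k)))
    Πp²-≤ {c} m≤t c≤t = begin
      c * (P * P)
        ≤⟨ *-mono-≤ (≤-trans c≤t (<⇒≤ t<T)) (*-mono-≤ P≤ P≤) ⟩
      2 ^ t * ((2 ^ suc t) ^ T * (2 ^ suc t) ^ T)
        ≡⟨ cong (λ z → 2 ^ t * (z * z)) (^-*-assoc 2 (suc t) T) ⟩
      2 ^ t * (2 ^ (suc t * T) * 2 ^ (suc t * T))
        ≡⟨ cong (λ z → 2 ^ t * z) (sym (^-distribˡ-+-* 2 (suc t * T) (suc t * T))) ⟩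
      2 ^ t * 2 ^ (suc t * T + suc t * T)
        ≡⟨ sym (^-distribˡ-+-* 2 t (suc t * T + suc t * T)) ⟩
      2 ^ (t + (suc t * T + suc t * T))
        ≤⟨ ^-monoʳ-≤ 2 (exponent-≤ t<T (≤-trans (s≤s (m^n>0 2 k)) t<T)) ⟩
      2 ^ (T * T * (T * T))
        ≡⟨ cong (2 ^_) (fourth-power t) ⟩
      2 ^ (2 ^ (2 ^ (2 + k)))  ∎
      where
      open ≤-Reasoning
      P≤ : P ≤ (2 ^ suc t) ^ T
      P≤ = Πp≤ m T (2 ^ suc t) (<-≤-trans (+-monoˡ-< T (≤-<-trans m≤t t<T))
        (≤-reflexive (cong (λ z → T + z) (sym (+-identityʳ T)))))

    Π[p+1]>0 : 0 < R
    Π[p+1]>0 = n≢0⇒n>0 (λ R≡0 → contradiction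
      (≤-trans (mertens m t) (≤-reflexive (cong (λ r → 2 * (r * 2+ m)) R≡0)))
      (<⇒≱ (*-mono-≤ (m^n>0 2 k) (Πp>0 m T))))

    -- The infinitude of primes in Euler's manner: t P ≤ 2 (m + 2) R ≤ 2 (m + 2) P², and P cancels.
    Πp-unbounded : ∀ N → 2 * 2+ m * suc N ≤ t → N < P
    Πp-unbounded N h = *-cancelˡ-≤ (2 * 2+ m) (*-cancelʳ-≤ _ _ P {{>-nonZero (Πp>0 m T)}} (begin
      2 * 2+ m * suc N * P      ≤⟨ *-monoˡ-≤ P h ⟩
      t * P                     ≤⟨ mertens m t ⟩
      2 * (R * 2+ m)            ≤⟨ *-monoʳ-≤ 2 (*-monoˡ-≤ (2+ m) (Π[p+1]≤ m T)) ⟩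
      2 * (P * P * 2+ m)        ≡⟨ eq P m ⟩
      2 * 2+ m * P * P          ∎))
      where
      open ≤-Reasoning
      eq : ∀ P m → 2 * (P * P * (2 + m)) ≡ 2 * (2 + m) * P * P
      eq = solve-∀

    -- Here 4 m P = 4 Q stands for √n and 2^(2 + k) = 4 t for log log n. The constant is 288 = 4 · 4
    -- · 2 · 9, with 2 (m + 2) from `mertens`, 9 m from the hypothesis and a further m from Q.
    density : ∀ r → P * R ≤ 9 * (m * P) * r → 4 * (m * P) * 2 ^ (2 + k) ≤ 288 * (m * m) * 2+ m * r
    density r PR≤ = begin
      4 * (m * P) * (2 * (2 * t))           ≡⟨ eq₁ m P t ⟩
      16 * m * (t * P)                      ≤⟨ *-monoʳ-≤ (16 * m) (mertens m t) ⟩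
      16 * m * (2 * (R * 2+ m))             ≤⟨ *-monoʳ-≤ (16 * m) (*-monoʳ-≤ 2 (*-monoˡ-≤ (2+ m) R≤)) ⟩
      16 * m * (2 * (9 * m * r * 2+ m))     ≡⟨ eq₂ m r ⟩
      288 * (m * m) * 2+ m * r              ∎
      where
      open ≤-Reasoning
      R≤ : R ≤ 9 * m * r
      R≤ = *-cancelˡ-≤ P {{>-nonZero (Πp>0 m T)}} (≤-trans PR≤ (≤-reflexive (eq m P r)))
        where
        eq : ∀ m P r → 9 * (m * P) * r ≡ P * (9 * m * r)
        eq = solve-∀
      eq₁ : ∀ m P t → 4 * (m * P) * (2 * (2 * t)) ≡ 16 * m * (t * P)
      eq₁ = solve-∀
      eq₂ : ∀ m r → 16 * m * (2 * (9 * m * r * (2 + m))) ≡ 288 * (m * m) * (2 + m) * r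
      eq₂ = solve-∀

-- From solutions modulo Q to representations.

module Counting where
  open import Defs
  open Estimates
  open Congruence
  open Sieve
  open import Data.Nat
  open import Data.Nat.Properties
  open import Data.Nat.Divisibility using (_∣_; m∣m*n; ∣⇒≤; m%n≡0⇒n∣m)
  open import Data.Nat.DivMod
    using (_/_; _%_; m/n*n≤m; m*n/n≡m; /-monoˡ-≤; m≡m%n+[m/n]*n; m%n<n)
  open import Data.Nat.Coprimality using (Coprime)
  open import Data.Nat.Primality using (Prime; prime?; euclidsLemma; prime⇒irreducible)
  open import Data.Nat.Tactic.RingSolver using (solve-∀)
  open import Data.Integer as ℤ using (ℤ; +_)
  import Data.Integer.Properties as ℤ
  import Data.Integer.Divisibility.Signed as ℤ
  import Data.Integer.DivMod as ℤ
  import Data.Integer.Tactic.RingSolver as ℤSolver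
  open import Data.Fin as Fin using (Fin; toℕ; fromℕ<; inject≤; combine)
  open import Data.Fin.Properties
    using (any?; toℕ<n; toℕ-injective; toℕ-fromℕ<; toℕ-inject≤; combine-injective;
      injective⇒≤)
  open import Data.List using (lookup)
  open import Data.List.Relation.Unary.Any using (index)
  open import Data.List.Relation.Unary.Any.Properties using (lookup-index)
  open import Data.Product using (Σ-syntax; ∃-syntax; _×_; _,_; proj₁; proj₂)
  open import Data.Sum using (inj₁; inj₂)
  open import Function.Bundles using (Equivalence)
  open import Relation.Nullary using (¬_; contradiction; yes; no)
  open import Relation.Binary.PropositionalEquality
    using (_≡_; refl; sym; trans; cong; cong₂; subst; subst₂)

  -- Otherwise every fibre has room for at most ⌊(k - 1) / M⌋ ranks, and the pairs of class and rank
  -- embed k elements into at most k - 1.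
  large-fibre : ∀ {k} M .{{_ : NonZero M}} (size : Fin M → ℕ) (v : Fin k → Fin M)
    (rank : ∀ i → Fin (size (v i))) →
    (∀ i j → v i ≡ v j → toℕ (rank i) ≡ toℕ (rank j) → i ≡ j) →
    0 < k → ∃[ x ] k ≤ M * size x
  large-fibre {suc k} M size v rank inj _ with any? (λ x → suc k ≤? M * size x)
  ... | yes found = found
  ... | no none = contradiction (injective⇒≤ {f = code} code-injective)
          (<⇒≱ (s≤s (≤-trans (≤-reflexive (*-comm M (k / M))) (m/n*n≤m k M))))
    where
    small : ∀ x → size x ≤ k / M
    small x = ≤-trans (≤-reflexive (sym (m*n/n≡m (size x) M))) (/-monoˡ-≤ M
      (s≤s⁻¹ (≰⇒> (λ h → none (x , ≤-trans h (≤-reflexive (*-comm (size x) M)))))))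
    code : Fin (suc k) → Fin (M * (k / M))
    code i = combine (v i) (inject≤ (rank i) (small (v i)))
    code-injective : ∀ {i j} → code i ≡ code j → i ≡ j
    code-injective {i} {j} eq with combine-injective (v i) _ (v j) _ eq
    ... | v≡ , r≡ = inj i j v≡ (trans (sym (toℕ-inject≤ (rank i) _)) (trans (cong toℕ r≡) (toℕ-inject≤ (rank j) _)))

  -- Representatives in [Q , 2 Q) make the sums of squares lie in [3 Q² , 12 Q²),
  -- an interval with 9 Q elements in each residue class modulo Q.
  many-representations : ∀ Q .{{_ : NonZero Q}} n₀ {k} → 0 < k → Solutions Q n₀ k →
    ∃[ n ] 3 * (Q * Q) ≤ n × n < 12 * (Q * Q) × + Q ℤ.∣ + n ℤ.- n₀ × k ≤ 9 * Q * r₃ n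
  many-representations Q n₀ {k} k>0 S =
    let x , k≤ = large-fibre (9 * Q) {{m*n≢0 9 Q}} (λ x → r₃ (value (toℕ x))) v rank inj k>0
    in value (toℕ x) , value≥ (toℕ x) , value< x , value-≡ (toℕ x) , k≤
    where
    open Solutions S
    -- The shift by Q provides the lower bound 3 Q² ≤ n, from which n > N will follow.
    lift : ℤ → ℕ
    lift x = x ℤ.%ℕ Q + Q
    lift-≡ : ∀ x → + Q ℤ.∣ + lift x ℤ.- x
    lift-≡ x = ℤ.divides (ℤ.1ℤ ℤ.- x ℤ./ℕ Q) (trans
      (cong₂ ℤ._-_ (ℤ.pos-+ (x ℤ.%ℕ Q) Q) (ℤ.a≡a%ℕn+[a/ℕn]*n x Q))
      (eq (+ (x ℤ.%ℕ Q)) (+ Q) (x ℤ./ℕ Q)))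
      where
      eq : ∀ r q d → r ℤ.+ q ℤ.- (r ℤ.+ d ℤ.* q) ≡ (ℤ.1ℤ ℤ.- d) ℤ.* q
      eq = ℤSolver.solve-∀
    lift₃ : Triple → ℕ × ℕ × ℕ
    lift₃ (x , y , z) = lift x , lift y , lift z
    cast : ℕ × ℕ × ℕ → Triple
    cast (a , b , c) = + a , + b , + c
    norm : ℕ × ℕ × ℕ → ℕ
    norm (a , b , c) = a * a + b * b + c * c
    cast-norm : ∀ s → sumOfSquares (cast s) ≡ + norm s
    cast-norm (a , b , c) = sym (trans (ℤ.pos-+ (a * a + b * b) (c * c)) (cong₂ ℤ._+_
      (trans (ℤ.pos-+ (a * a) (b * b)) (cong₂ ℤ._+_ (ℤ.pos-* a a) (ℤ.pos-* b b))) (ℤ.pos-* c c)))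
    t : Fin k → ℕ × ℕ × ℕ
    t i = lift₃ (point i)
    t-≋ : ∀ i → cast (t i) ≋ point i [ Q ]
    t-≋ i = lift-≡ (proj₁ (point i)) , lift-≡ (proj₁ (proj₂ (point i))) , lift-≡ (proj₂ (proj₂ (point i)))
    norm≥ : ∀ s → 3 * (Q * Q) ≤ norm (lift₃ s)
    norm≥ (x , y , z) = ≤-trans (≤-reflexive (eq (Q * Q))) (+-mono-≤ (+-mono-≤ (square≥ x) (square≥ y)) (square≥ z))
      where
      eq : ∀ q → 3 * q ≡ q + q + q
      eq = solve-∀
      square≥ : ∀ x → Q * Q ≤ lift x * lift x
      square≥ x = *-mono-≤ (m≤n+m Q (x ℤ.%ℕ Q)) (m≤n+m Q (x ℤ.%ℕ Q))
    norm< : ∀ s → norm (lift₃ s) < 12 * (Q * Q)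
    norm< (x , y , z) = <-≤-trans (+-mono-< (+-mono-< (square< x) (square< y)) (square< z)) (≤-reflexive (eq Q))
      where
      eq : ∀ q → (q + q) * (q + q) + (q + q) * (q + q) + (q + q) * (q + q) ≡ 12 * (q * q)
      eq = solve-∀
      square< : ∀ x → lift x * lift x < (Q + Q) * (Q + Q)
      square< x = *-mono-< (+-monoˡ-< Q (ℤ.n%ℕd<d x Q)) (+-monoˡ-< Q (ℤ.n%ℕd<d x Q))
    ρ : ℕ
    ρ = n₀ ℤ.%ℕ Q
    -- The quotients by Q of the sums of squares lie in [3 Q , 12 Q); x counts them from 3 Q.
    value : ℕ → ℕ
    value x = ρ + (3 * Q + x) * Q
    norm-≡ : ∀ i → + Q ℤ.∣ + norm (t i) ℤ.- n₀
    norm-≡ i = subst (λ z → + Q ℤ.∣ z ℤ.- n₀) (cast-norm (t i))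
      (∣-telescope (sumOfSquares (cast (t i))) (sumOfSquares (point i)) n₀
        (sumOfSquares-cong (cast (t i)) (point i) (t-≋ i)) (sound i))
    norm%Q : ∀ i → norm (t i) % Q ≡ ρ
    norm%Q i = small-∣⇒≡ _ _ (m%n<n (norm (t i)) Q) (ℤ.n%ℕd<d n₀ Q)
      (∣-lin₂ ℤ.1ℤ (n₀ ℤ./ℕ Q ℤ.- + (norm (t i) / Q)) (norm-≡ i) ℤ.∣-refl
        (trans (cong₂ (λ x y → ℤ.1ℤ ℤ.* (x ℤ.- y) ℤ.+ (n₀ ℤ./ℕ Q ℤ.- + (norm (t i) / Q)) ℤ.* + Q)
            (trans (cong +_ (m≡m%n+[m/n]*n (norm (t i)) Q))
              (trans (ℤ.pos-+ (norm (t i) % Q) _) (cong (λ z → + (norm (t i) % Q) ℤ.+ z) (ℤ.pos-* (norm (t i) / Q) Q))))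
            (ℤ.a≡a%ℕn+[a/ℕn]*n n₀ Q))
          (eq (+ (norm (t i) % Q)) (+ (norm (t i) / Q)) (+ ρ) (n₀ ℤ./ℕ Q) (+ Q))))
      where
      eq : ∀ r d r′ d′ q → ℤ.1ℤ ℤ.* (r ℤ.+ d ℤ.* q ℤ.- (r′ ℤ.+ d′ ℤ.* q)) ℤ.+ (d′ ℤ.- d) ℤ.* q ≡ r ℤ.- r′
      eq = ℤSolver.solve-∀
    quotient≥ : ∀ i → 3 * Q ≤ norm (t i) / Q
    quotient≥ i = ≤-trans (≤-reflexive (trans (sym (m*n/n≡m (3 * Q) Q)) (cong (_/ Q) (*-assoc 3 Q Q))))
      (/-monoˡ-≤ Q (norm≥ (point i)))
    quotient< : ∀ i → norm (t i) / Q < 12 * Q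
    quotient< i = *-cancelʳ-< Q _ _ (≤-<-trans (m/n*n≤m (norm (t i)) Q)
      (<-≤-trans (norm< (point i)) (≤-reflexive (sym (*-assoc 12 Q Q)))))
    offset< : ∀ i → norm (t i) / Q ∸ 3 * Q < 9 * Q
    offset< i = +-cancelˡ-< (3 * Q) _ _ (≤-<-trans (≤-reflexive (m+[n∸m]≡n (quotient≥ i)))
      (<-≤-trans (quotient< i) (≤-reflexive (eq Q))))
      where
      eq : ∀ q → 12 * q ≡ 3 * q + 9 * q
      eq = solve-∀
    v : Fin k → Fin (9 * Q)
    v i = fromℕ< (offset< i)
    norm≡value : ∀ i → norm (t i) ≡ value (toℕ (v i))
    norm≡value i = trans (m≡m%n+[m/n]*n (norm (t i)) Q) (cong₂ (λ r d → r + d * Q) (norm%Q i)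
      (sym (trans (cong (λ z → 3 * Q + z) (toℕ-fromℕ< (offset< i))) (m+[n∸m]≡n (quotient≥ i)))))
    member : ∀ i → _
    member i = Equivalence.from (∈-representations (value (toℕ (v i))) (cast (t i)))
      (trans (cast-norm (t i)) (cong +_ (norm≡value i)))
    rank : ∀ i → Fin (r₃ (value (toℕ (v i))))
    rank i = index (member i)
    lookup-≡ : ∀ {x y : Fin (9 * Q)} (r : Fin (r₃ (value (toℕ x)))) (s : Fin (r₃ (value (toℕ y)))) →
      x ≡ y → toℕ r ≡ toℕ s → lookup (representations (value (toℕ x))) r ≡ lookup (representations (value (toℕ y))) s
    lookup-≡ {x} r s refl r≡s = cong (lookup (representations (value (toℕ x)))) (toℕ-injective r≡s)
    -- Equal values and equal positions in `representations` give the same lifted triple, so the two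
    -- points agree modulo Q.
    inj : ∀ i j → v i ≡ v j → toℕ (rank i) ≡ toℕ (rank j) → i ≡ j
    inj i j v≡ r≡ = distinct i j (≋-trans (point i) (cast (t i)) (point j)
      (≋-sym (cast (t i)) (point i) (t-≋ i))
      (subst (_≋ point j [ Q ]) (sym (trans (lookup-index (member i))
        (trans (lookup-≡ (rank i) (rank j) v≡ r≡) (sym (lookup-index (member j)))))) (t-≋ j)))
    value≥ : ∀ x → 3 * (Q * Q) ≤ value x
    value≥ x = ≤-trans (≤-trans (≤-reflexive (sym (*-assoc 3 Q Q))) (*-monoˡ-≤ Q (m≤m+n (3 * Q) x)))
      (m≤n+m _ ρ)
    value< : ∀ (x : Fin (9 * Q)) → value (toℕ x) < 12 * (Q * Q)
    value< x = <-≤-trans (+-monoˡ-< _ (ℤ.n%ℕd<d n₀ Q)) (≤-trans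
      (*-monoˡ-≤ Q (subst (_≤ 3 * Q + 9 * Q) (+-suc (3 * Q) (toℕ x)) (+-monoʳ-≤ (3 * Q) (toℕ<n x))))
      (≤-reflexive (eq Q)))
      where
      eq : ∀ q → (3 * q + 9 * q) * q ≡ 12 * (q * q)
      eq = solve-∀
    value-≡ : ∀ x → + Q ℤ.∣ + value x ℤ.- n₀
    value-≡ x = ℤ.divides (+ (3 * Q + x) ℤ.- n₀ ℤ./ℕ Q) (trans
      (cong₂ ℤ._-_ (trans (ℤ.pos-+ ρ _) (cong (λ z → + ρ ℤ.+ z) (ℤ.pos-* (3 * Q + x) Q)))
        (ℤ.a≡a%ℕn+[a/ℕn]*n n₀ Q))
      (eq (+ ρ) (+ (3 * Q + x)) (n₀ ℤ./ℕ Q) (+ Q)))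
      where
      eq : ∀ r d d′ q → r ℤ.+ d ℤ.* q ℤ.- (r ℤ.+ d′ ℤ.* q) ≡ (d ℤ.- d′) ℤ.* q
      eq = ℤSolver.solve-∀

  odd-prime : ∀ {p} → Prime p → 2 < p → ∃[ h ] p ≡ suc (h + h)
  odd-prime {p} p-prime 2<p with p % 2 in eq | m≡m%n+[m/n]*n p 2 | m%n<n p 2
  ... | 0 | _ | _ with prime⇒irreducible p-prime (m%n≡0⇒n∣m p 2 eq)
  ...   | inj₁ ()
  ...   | inj₂ refl = contradiction 2<p (<-irrefl refl)
  odd-prime {p} p-prime 2<p | 1 | e | _ = p / 2 , trans e (cong suc (double (p / 2)))
    where
    double : ∀ h → h * 2 ≡ h + h
    double = solve-∀
  odd-prime {p} p-prime 2<p | suc (suc _) | _ | s≤s (s≤s ())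

  prime∤⇒coprime : ∀ {Q p} → Prime p → ¬ p ∣ Q → Coprime Q p
  prime∤⇒coprime p-prime p∤Q (d∣Q , d∣p) with prime⇒irreducible p-prime d∣p
  ... | inj₁ d≡1  = d≡1
  ... | inj₂ refl = contradiction d∣Q p∤Q

  module _ {m} (m>0 : 0 < m) {a : ℤ} {z : Triple} (z-sound : + m ℤ.∣ sumOfSquares z ℤ.- a) where

    -- Primes enter one at a time, each multiplying the count by p² + p = p (p + 1). A new p exceeds
    -- m and all earlier primes, so it is coprime to the modulus, and p ≥ m + 2 ≥ 3 makes it odd.
    -- The start is the single class of z modulo m.
    solutions : ∀ i → Σ[ n₀ ∈ ℤ ] + m ℤ.∣ n₀ ℤ.- a ×
      Solutions (m * Πp m i) n₀ (Πp m i * Π[p+1] m i)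
    solutions zero = a , ℤ.divides ℤ.0ℤ (ℤ.i≡j⇒i-j≡0 {a} refl) , record
      { point    = λ _ → z
      ; sound    = λ _ → subst (λ q → + q ℤ.∣ sumOfSquares z ℤ.- a) (sym (*-identityʳ m)) z-sound
      ; distinct = λ { Fin.zero Fin.zero _ → refl }
      }
    solutions (suc i) with prime? (2+ (m + i)) | solutions i
    ... | no _ | ih = ih
    ... | yes p-prime | n₀ , m∣ , S with odd-prime p-prime (s≤s (s≤s (≤-trans m>0 (m≤m+n m i))))
    ...   | h , p≡ =
        let n₂ , Q∣ , T = combine-solutions (prime∤⇒coprime p-prime p∤Q) S primeSolutions
        in n₂ , ∣-telescope n₂ n₀ a (ℤ.∣-trans m∣Q Q∣) m∣
           , subst₂ (λ Q k → Solutions Q n₂ k) (*-assoc m P p) (eq P (Π[p+1] m i) p) T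
      where
      p = 2+ (m + i)
      P = Πp m i
      primeSolutions : Solutions p (ℤ.- ℤ.1ℤ) (p * p + p)
      primeSolutions = subst (λ p → Solutions p (ℤ.- ℤ.1ℤ) (p * p + p)) (sym p≡)
        (solutions-prime {h} (subst Prime p≡ p-prime))
      p∤Q : ¬ p ∣ m * P
      p∤Q p∣mP with euclidsLemma m P p-prime p∣mP
      ... | inj₁ p∣m = <⇒≱ (s≤s (≤-trans (m≤m+n m i) (n≤1+n (m + i)))) (∣⇒≤ {{>-nonZero m>0}} p∣m)
      ... | inj₂ p∣P = Πp-∤ m i p p-prime ≤-refl p∣P
      m∣Q : + m ℤ.∣ + (m * P)
      m∣Q = ℤ.∣ᵤ⇒∣ (m∣m*n P)
      eq : ∀ P R p → P * R * (p * p + p) ≡ P * p * (R * (1 + p))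
      eq = solve-∀

    -- The first condition on k forces P > N, the second absorbs the factor in n < 12 Q² = 12 m² P².
    -- The witness s = 4 Q exceeds √n because 12 ≤ 16.
    large-r₃-at : ∀ k N → 2 * 2+ m * suc N ≤ 2 ^ k → 12 * (m * m) ≤ 2 ^ k →
      ∃[ n ] ∃[ s ] N < n × + m ℤ.∣ + n ℤ.- a × 3 ≤ n × n ≤ s * s ×
        n ≤ 2 ^ (2 ^ (2 ^ (2 + k))) × s * 2 ^ (2 + k) ≤ 288 * (m * m) * 2+ m * r₃ n
    large-r₃-at k N N≤ 12mm≤ =
      let n₀ , m∣ , S = solutions T
          n , 3QQ≤n , n<12QQ , Q∣ , PR≤ = many-representations Q {{>-nonZero Q>0}} n₀
            (*-mono-≤ (Πp>0 m T) (Π[p+1]>0 m k)) S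
      in n , 4 * Q
        , <-≤-trans (Πp-unbounded m k N N≤) (≤-trans P≤3QQ 3QQ≤n)
        , ∣-telescope (+ n) n₀ a (ℤ.∣-trans (ℤ.∣ᵤ⇒∣ (m∣m*n P)) Q∣) m∣
        , ≤-trans (*-monoʳ-≤ 3 (*-mono-≤ Q>0 Q>0)) 3QQ≤n
        , ≤-trans (<⇒≤ n<12QQ) (≤-trans (m≤n+m _ (4 * (Q * Q))) (≤-reflexive (eq₁ Q)))
        , ≤-trans (<⇒≤ n<12QQ) (≤-trans (≤-reflexive (eq₂ m P)) (Πp²-≤ m k m≤t 12mm≤))
        , density m k (r₃ n) PR≤
      where
      T = 2 ^ (2 ^ k)
      P = Πp m T
      Q = m * P
      Q>0 : 0 < Q
      Q>0 = *-mono-≤ m>0 (Πp>0 m T)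
      m≤t : m ≤ 2 ^ k
      m≤t = ≤-trans (m≤m*n m m {{>-nonZero m>0}}) (≤-trans (m≤n*m (m * m) 12) 12mm≤)
      P≤3QQ : P ≤ 3 * (Q * Q)
      P≤3QQ = ≤-trans (m≤n*m P m {{>-nonZero m>0}})
        (≤-trans (m≤m*n Q Q {{>-nonZero Q>0}}) (m≤n*m (Q * Q) 3))
      eq₁ : ∀ Q → 4 * (Q * Q) + 12 * (Q * Q) ≡ 4 * Q * (4 * Q)
      eq₁ = solve-∀
      eq₂ : ∀ m P → 12 * (m * P * (m * P)) ≡ 12 * (m * m) * (P * P)
      eq₂ = solve-∀

    large-r₃ : ∀ N → ∃[ n ] ∃[ s ] ∃[ j ] N < n × + m ℤ.∣ + n ℤ.- a × 3 ≤ n × n ≤ s * s ×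
      n ≤ 2 ^ (2 ^ (2 ^ j)) × s * 2 ^ j ≤ 288 * (m * m) * 2+ m * r₃ n
    large-r₃ N =
      let n , s , bounds = large-r₃-at k N (≤-trans (m≤m+n _ (12 * (m * m))) (<⇒≤ (n<2^n k)))
                             (≤-trans (m≤n+m _ (2 * 2+ m * suc N)) (<⇒≤ (n<2^n k)))
      in n , s , 2 + k , bounds
      where
      k = 2 * 2+ m * suc N + 12 * (m * m)

-- Upper bounds for the Dedekind reals of the statement.

module Reals where
  open import Defs
  open import Data.Nat as ℕ using (ℕ; zero; suc)
  import Data.Nat.Properties as ℕ
  open import Data.Integer as ℤ using (+_)
  import Data.Integer.Properties as ℤ
  open import Data.Rational
  open import Data.Rational.Properties
  import Data.Rational.Unnormalised as ℚᵘ
  import Data.Rational.Unnormalised.Properties as ℚᵘ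
  open import Data.Product using (Σ-syntax; _,_; proj₁)
  open import Data.Sum using (_⊎_; inj₁; inj₂)
  open import Data.Empty using (⊥-elim)
  open import Relation.Nullary using (contradiction; yes; no)
  open import Relation.Nullary.Decidable using (from-yes)
  open import Relation.Binary.PropositionalEquality
    using (_≡_; refl; sym; trans; cong; cong₂; subst)

  open ℝ

  ℕ→ℚ-unnormalised : ∀ n → toℚᵘ (ℕ→ℚ n) ℚᵘ.≃ ℚᵘ.mkℚᵘ (+ n) 0
  ℕ→ℚ-unnormalised n = toℚᵘ-fromℚᵘ (ℚᵘ.mkℚᵘ (+ n) 0)

  ℕ→ℚ-mono-≤ : ∀ {m n} → m ℕ.≤ n → ℕ→ℚ m ≤ ℕ→ℚ n
  ℕ→ℚ-mono-≤ {m} {n} m≤n = toℚᵘ-cancel-≤ {ℕ→ℚ m} {ℕ→ℚ n}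
    (ℚᵘ.≤-respˡ-≃ {toℚᵘ (ℕ→ℚ n)} (ℚᵘ.≃-sym {toℚᵘ (ℕ→ℚ m)} (ℕ→ℚ-unnormalised m))
      (ℚᵘ.≤-respʳ-≃ {ℚᵘ.mkℚᵘ (+ m) 0} (ℚᵘ.≃-sym {toℚᵘ (ℕ→ℚ n)} (ℕ→ℚ-unnormalised n))
        (ℚᵘ.*≤* (ℤ.*-monoʳ-≤-nonNeg (+ 1) (ℤ.+≤+ m≤n)))))

  ℕ→ℚ-* : ∀ m n → ℕ→ℚ (m ℕ.* n) ≡ ℕ→ℚ m * ℕ→ℚ n
  ℕ→ℚ-* m n = toℚᵘ-injective (ℚᵘ.≃-trans {toℚᵘ (ℕ→ℚ (m ℕ.* n))} (ℕ→ℚ-unnormalised (m ℕ.* n))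
    (ℚᵘ.≃-trans {ℚᵘ.mkℚᵘ (+ (m ℕ.* n)) 0} (ℚᵘ.*≡* (cong (ℤ._* + 1) (ℤ.pos-* m n)))
      (ℚᵘ.≃-sym {toℚᵘ (ℕ→ℚ m * ℕ→ℚ n)}
        (ℚᵘ.≃-trans {toℚᵘ (ℕ→ℚ m * ℕ→ℚ n)} (toℚᵘ-homo-* (ℕ→ℚ m) (ℕ→ℚ n))
          (ℚᵘ.*-cong {toℚᵘ (ℕ→ℚ m)} (ℕ→ℚ-unnormalised m) (ℕ→ℚ-unnormalised n))))))

  0≤ℕ→ℚ : ∀ n → 0ℚ ≤ ℕ→ℚ n
  0≤ℕ→ℚ n = ℕ→ℚ-mono-≤ {0} {n} ℕ.z≤n

  expApprox-nonNeg : ∀ i q → 0ℚ ≤ expApprox i q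
  expApprox-nonNeg zero    q = p≤p⊔q 0ℚ (1ℚ + q)
  expApprox-nonNeg (suc i) q = subst (_≤ expApprox i (½ * q) * expApprox i (½ * q)) (*-zeroʳ (expApprox i (½ * q)))
    (*-monoˡ-≤-nonNeg (expApprox i (½ * q)) {{nonNegative (expApprox-nonNeg i (½ * q))}} (expApprox-nonNeg i (½ * q)))

  *-mono-≤-nonNeg : ∀ {a b c d} → 0ℚ ≤ a → a ≤ b → 0ℚ ≤ d → c ≤ d → a * c ≤ b * d
  *-mono-≤-nonNeg {a} {b} {c} {d} 0≤a a≤b 0≤d c≤d = ≤-trans
    (*-monoˡ-≤-nonNeg a {{nonNegative 0≤a}} c≤d) (*-monoʳ-≤-nonNeg d {{nonNegative 0≤d}} a≤b)

  expApprox-mono-≤ : ∀ i {p q} → p ≤ q → expApprox i p ≤ expApprox i q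
  expApprox-mono-≤ zero    p≤q = ⊔-monoʳ-≤ 0ℚ (+-monoʳ-≤ 1ℚ p≤q)
  expApprox-mono-≤ (suc i) {p} {q} p≤q = *-mono-≤-nonNeg (expApprox-nonNeg i _) ih (expApprox-nonNeg i _) ih
    where
    ih : expApprox i (½ * p) ≤ expApprox i (½ * q)
    ih = expApprox-mono-≤ i (*-monoˡ-≤-nonNeg ½ p≤q)

  -- Halving 2^j exactly j times gives 1, so the approximation is (1 + 1) raised to 2^j.
  expApprox-2^ : ∀ j → expApprox j (ℕ→ℚ (2 ℕ.^ j)) ≡ ℕ→ℚ (2 ℕ.^ (2 ℕ.^ j))
  expApprox-2^ zero    = refl
  expApprox-2^ (suc j) = trans (cong (λ q → expApprox j q * expApprox j q) half)
    (trans (cong₂ _*_ (expApprox-2^ j) (expApprox-2^ j))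
      (trans (sym (ℕ→ℚ-* (2 ℕ.^ (2 ℕ.^ j)) (2 ℕ.^ (2 ℕ.^ j))))
        (cong ℕ→ℚ (trans (sym (ℕ.^-distribˡ-+-* 2 (2 ℕ.^ j) (2 ℕ.^ j)))
          (cong (λ z → 2 ℕ.^ (2 ℕ.^ j ℕ.+ z)) (sym (ℕ.+-identityʳ (2 ℕ.^ j))))))))
    where
    half : ½ * ℕ→ℚ (2 ℕ.^ suc j) ≡ ℕ→ℚ (2 ℕ.^ j)
    half = trans (cong (½ *_) (ℕ→ℚ-* 2 (2 ℕ.^ j)))
      (trans (sym (*-assoc ½ (ℕ→ℚ 2) (ℕ→ℚ (2 ℕ.^ j)))) (*-identityˡ (ℕ→ℚ (2 ℕ.^ j))))

  infix 4 _≼_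
  -- An upper bound tested on the lower cut, since `_≤ℝ_` compares lower cuts.
  _≼_ : ℝ → ℚ → Set
  x ≼ q = ∀ p → L x p → p ≤ q

  -- exp (2ʲ) ≥ (1 + 2ʲ/2ʲ) ^ 2ʲ = 2 ^ 2ʲ
  log-≼ : ∀ j x x>0 → x ≼ ℕ→ℚ (2 ℕ.^ (2 ℕ.^ j)) → log x x>0 ≼ ℕ→ℚ (2 ℕ.^ j)
  log-≼ j x x>0 x≼ q (r , (i , 1<rE) , lr) with ℕ→ℚ (2 ℕ.^ j) <? q
  ... | no ¬h = ≮⇒≥ ¬h
  ... | yes B<q =
    -- If B < q, then r lies below exp B, as r < x ≤ 2^(2^j) ≤ exp B, and above it, as exp B ≤ exp q
    -- < r.
    let r′ , r<r′ , lr′ = L-open x lr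
        r<E = subst (r <_) (sym (expApprox-2^ j)) (<-≤-trans r<r′ (x≼ r′ lr′))
    in ⊥-elim (disjoint (exp B) {r} (j , r<E) (i , <-≤-trans 1<rE
         (*-monoˡ-≤-nonNeg r {{nonNegative 0≤r}} (expApprox-mono-≤ i (neg-antimono-≤ (<⇒≤ B<q))))))
    where
    B = ℕ→ℚ (2 ℕ.^ j)
    G = expApprox i (- q)
    0≤r : 0ℚ ≤ r
    0≤r with 0ℚ ≤? r
    ... | yes h = h
    ... | no ¬h = contradiction (<-≤-trans 1<rE (subst (r * G ≤_) (*-zeroˡ G)
          (*-monoʳ-≤-nonNeg G {{nonNegative (expApprox-nonNeg i (- q))}} (<⇒≤ (≰⇒> ¬h)))))
          (<-asym (from-yes (0ℚ <? 1ℚ)))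

  sqrt-≼ : ∀ x s → 0ℚ ≤ s → x ≼ s * s → sqrt x ≼ s
  sqrt-≼ x s 0≤s x≼ q (inj₁ q<0) = ≤-trans (<⇒≤ q<0) 0≤s
  sqrt-≼ x s 0≤s x≼ q (inj₂ lqq) with q ≤? s
  ... | yes h = h
  ... | no ¬h = ⊥-elim (<-irrefl refl (<-≤-trans (≤-<-trans
      (*-monoˡ-≤-nonNeg s {{nonNegative 0≤s}} (<⇒≤ s<q))
      (*-monoˡ-<-pos q {{positive (≤-<-trans 0≤s s<q)}} s<q)) (x≼ (q * q) lqq)))
    where
    s<q : s < q
    s<q = ≰⇒> ¬h

  -- Nonnegativity read off the upper cut; 0 has this property too.
  Positiveᵁ : ℝ → Set
  Positiveᵁ x = ∀ q → U x q → 0ℚ < q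

  *ℝ-Positiveᵁ : ∀ x y → Positiveᵁ x → Positiveᵁ y → Positiveᵁ (x *ℝ y)
  *ℝ-Positiveᵁ x y x⁺ y⁺ q (a , b , c , d , la , ub , lc , ud , _ , _ , _ , bd<q) =
    <-trans (subst (_< b * d) (*-zeroʳ b) (*-monoʳ-<-pos b {{positive (x⁺ b ub)}} (y⁺ d ud))) bd<q

  -- If the lower end a around x is negative, q < 0 or q ≤ 0 must come from a corner: a c ≤ 0 when c
  -- ≥ 0, and b c ≤ 0 when c ≤ 0, since b > 0. For a ≥ 0 the corner a c is at most X Y.
  *ℝ-≼ : ∀ x y {X Y} → 0ℚ ≤ X → 0ℚ ≤ Y → Positiveᵁ x → x ≼ X → y ≼ Y → x *ℝ y ≼ X * Y
  *ℝ-≼ x y {X} {Y} 0≤X 0≤Y x⁺ x≼ y≼ q (a , b , c , d , la , ub , lc , ud , q<ac , _ , q<bc , _)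
    with 0ℚ ≤? a
  ... | yes 0≤a = ≤-trans (<⇒≤ q<ac) (*-mono-≤-nonNeg 0≤a (x≼ a la) 0≤Y (y≼ c lc))
  ... | no ¬0≤a = ≤-trans (q≤0 (≤-total 0ℚ c))
      (subst (_≤ X * Y) (*-zeroʳ X) (*-monoˡ-≤-nonNeg X {{nonNegative 0≤X}} 0≤Y))
    where
    q≤0 : 0ℚ ≤ c ⊎ c ≤ 0ℚ → q ≤ 0ℚ
    q≤0 (inj₁ 0≤c) = ≤-trans (<⇒≤ q<ac) (subst (a * c ≤_) (*-zeroˡ c)
      (*-monoʳ-≤-nonNeg c {{nonNegative 0≤c}} (<⇒≤ (≰⇒> ¬0≤a))))
    q≤0 (inj₂ c≤0) = ≤-trans (<⇒≤ q<bc) (subst (b * c ≤_) (*-zeroʳ b)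
      (*-monoˡ-≤-nonNeg b {{nonNegative (<⇒≤ (x⁺ b ub))}} c≤0))

  module _ (D : ℕ) (D>0 : 0 ℕ.< D) where

    private
      0<ιD : 0ℚ < ℕ→ℚ D
      0<ιD = <-≤-trans (from-yes (0ℚ <? 1ℚ)) (ℕ→ℚ-mono-≤ {1} {D} D>0)

    reciprocal : ℚ
    reciprocal = (1/ ℕ→ℚ D) {{>-nonZero 0<ιD}}

    reciprocal>0 : 0ℚ < reciprocal
    reciprocal>0 = positive⁻¹ reciprocal {{1/pos⇒pos (ℕ→ℚ D) {{positive 0<ιD}}}}

    0<fromℚ-reciprocal : 0ℝ <ℝ fromℚ reciprocal
    0<fromℚ-reciprocal = <-dense reciprocal>0

    reciprocal-bound : ∀ a b r → a ℕ.* b ℕ.≤ D ℕ.* r → reciprocal * ℕ→ℚ a * ℕ→ℚ b ≤ ℕ→ℚ r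
    reciprocal-bound a b r ab≤Dr = ≤-trans
      (≤-reflexive (trans (*-assoc reciprocal (ℕ→ℚ a) (ℕ→ℚ b)) (cong (reciprocal *_) (sym (ℕ→ℚ-* a b)))))
      (≤-trans (*-monoˡ-≤-nonNeg reciprocal {{nonNegative (<⇒≤ reciprocal>0)}} (ℕ→ℚ-mono-≤ ab≤Dr))
        (≤-reflexive (trans (cong (reciprocal *_) (ℕ→ℚ-* D r))
          (trans (sym (*-assoc reciprocal (ℕ→ℚ D) (ℕ→ℚ r)))
            (trans (cong (_* ℕ→ℚ r) (*-inverseˡ (ℕ→ℚ D) {{>-nonZero 0<ιD}})) (*-identityˡ (ℕ→ℚ r)))))))

    √n·loglog-bound : ∀ n s j r → 3 ℕ.≤ n → n ℕ.≤ s ℕ.* s → n ℕ.≤ 2 ℕ.^ (2 ℕ.^ (2 ℕ.^ j)) →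
      s ℕ.* 2 ℕ.^ j ℕ.≤ D ℕ.* r →
      Σ[ n>0 ∈ 0ℝ <ℝ fromℕ n ] Σ[ logn>0 ∈ 0ℝ <ℝ log (fromℕ n) n>0 ]
        fromℚ reciprocal *ℝ sqrt (fromℕ n) *ℝ log (log (fromℕ n) n>0) logn>0 ≤ℝ fromℕ r
    √n·loglog-bound n s j r 3≤n n≤ss n≤ s≤Dr = n>0 , logn>0 , bound
      where
      3≤ιn : ℕ→ℚ 3 ≤ ℕ→ℚ n
      3≤ιn = ℕ→ℚ-mono-≤ 3≤n
      n>0 : 0ℝ <ℝ fromℕ n
      n>0 = ½ , from-yes (0ℚ <? ½) , <-≤-trans (from-yes (½ <? ℕ→ℚ 3)) 3≤ιn
      logn>0 : 0ℝ <ℝ log (fromℕ n) n>0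
      -- exp ½ ≤ 1 / (1 - ½) = 2 < 5/2 < 3 ≤ n.
      logn>0 = ½ , from-yes (0ℚ <? ½) , + 5 / 2 , (0 , from-yes (1ℚ <? + 5 / 2 * expApprox 0 (- ½)))
        , <-≤-trans (from-yes (+ 5 / 2 <? ℕ→ℚ 3)) 3≤ιn
      c√n : ℝ
      c√n = fromℚ reciprocal *ℝ sqrt (fromℕ n)
      c√n-≼ : c√n ≼ reciprocal * ℕ→ℚ s
      c√n-≼ = *ℝ-≼ (fromℚ reciprocal) (sqrt (fromℕ n)) (<⇒≤ reciprocal>0) (0≤ℕ→ℚ s)
        (λ _ → <-trans reciprocal>0) (λ _ → <⇒≤)
        (sqrt-≼ (fromℕ n) (ℕ→ℚ s) (0≤ℕ→ℚ s) (λ q q<n → ≤-trans (<⇒≤ q<n)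
          (subst (ℕ→ℚ n ≤_) (ℕ→ℚ-* s s) (ℕ→ℚ-mono-≤ n≤ss))))
      loglog-≼ : log (log (fromℕ n) n>0) logn>0 ≼ ℕ→ℚ (2 ℕ.^ j)
      loglog-≼ = log-≼ j (log (fromℕ n) n>0) logn>0 (log-≼ (2 ℕ.^ j) (fromℕ n) n>0
        (λ q q<n → ≤-trans (<⇒≤ q<n) (ℕ→ℚ-mono-≤ n≤)))
      bound : c√n *ℝ log (log (fromℕ n) n>0) logn>0 ≤ℝ fromℕ r
      bound q lq =
        -- `≼` yields only a weak inequality; the larger q′ in the open cut restores the strict one.
        let q′ , q<q′ , lq′ = L-open (c√n *ℝ log (log (fromℕ n) n>0) logn>0) lq
        in <-≤-trans q<q′ (≤-trans
             (*ℝ-≼ c√n (log (log (fromℕ n) n>0) logn>0) 0≤cs (0≤ℕ→ℚ (2 ℕ.^ j))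
               (*ℝ-Positiveᵁ (fromℚ reciprocal) (sqrt (fromℕ n)) (λ _ → <-trans reciprocal>0) (λ _ → proj₁))
               c√n-≼ loglog-≼ q′ lq′)
             (reciprocal-bound s (2 ℕ.^ j) r s≤Dr))
        where
        0≤cs : 0ℚ ≤ reciprocal * ℕ→ℚ s
        0≤cs = subst (_≤ reciprocal * ℕ→ℚ s) (*-zeroʳ reciprocal)
          (*-monoˡ-≤-nonNeg reciprocal {{nonNegative (<⇒≤ reciprocal>0)}} (0≤ℕ→ℚ s))

open import Defs
open import Data.Integer using (ℤ; +_)
open import Data.Integer.Divisibility.Signed using (∣ᵤ⇒∣; ∣⇒∣ᵤ)
open import Data.Nat using (ℕ; _<_; _*_; 2+; s≤s; z≤n)
open import Data.Nat.Properties using (*-mono-≤)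
open import Data.Product using (Σ-syntax; ∃-syntax; _×_; _,_)
open Counting using (large-r₃)
open Reals using (reciprocal; 0<fromℚ-reciprocal; √n·loglog-bound)

theorem1p1 : (m : ℕ) → 0 < m →
    Σ[ c ∈ ℝ ] 0ℝ <ℝ c ×
    ((a : ℤ) →
    (∃[ z₁ ] ∃[ z₂ ] ∃[ z₃ ] sumOfSquares (z₁ , z₂ , z₃) ≡ a ⟨mod m ⟩) →
    (N : ℕ) →
    ∃[ n ] N < n × (+ n) ≡ a ⟨mod m ⟩ ×
    (Σ[ n>0 ∈ 0ℝ <ℝ fromℕ n ]
    Σ[ logn>0 ∈ 0ℝ <ℝ log (fromℕ n) n>0 ]
    c *ℝ sqrt (fromℕ n) *ℝ log (log (fromℕ n) n>0) logn>0 ≤ℝ fromℕ (r₃ n)))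
theorem1p1 m m>0 = fromℚ (reciprocal D D>0) , 0<fromℚ-reciprocal D D>0 ,
  λ a (z₁ , z₂ , z₃ , z-sound) N →
    let n , s , j , N<n , n≡a , 3≤n , n≤s² , n≤2^2^2^j , s2ʲ≤Dr₃ =
          large-r₃ m>0 {a} {z₁ , z₂ , z₃} (∣ᵤ⇒∣ z-sound) N
    in n , N<n , ∣⇒∣ᵤ n≡a , √n·loglog-bound D D>0 n s j (r₃ n) 3≤n n≤s² n≤2^2^2^j s2ʲ≤Dr₃
  where
  D : ℕ
  -- The constant of `density`. It involves m alone, so c = 1 / D is fixed before a and N.
  D = 288 * (m * m) * 2+ m
  D>0 : 0 < D
  D>0 = *-mono-≤ (*-mono-≤ {1} {288} (s≤s z≤n) (*-mono-≤ m>0 m>0)) (s≤s z≤n)
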